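{- For every integer $r>2$ there is an integer $N(r)$ such that every $2$-connected graph of order at least $N(r)$ contains, as an induced subgraph, a graph isomorphic to one of the following: the complete graph $K_r$; a clean ladder of order at least $r$; a member of the family $\mathscr{K}_{2,r}$; a member of the family $\mathscr{K}_{2,r}^+$.
   Context: All graphs are finite, simple and undirected. The order of a graph is its number of vertices. For an integer $r>2$, $\mathscr{K}_{2,r}$ is the family of graphs obtained from the complete bipartite graph $K_{2,r}$ by subdividing each of its edges an arbitrary number, possibly zero, of times (different edges may be subdivided different numbers of times). $\mathscr{K}_{2,r}^+$ is the family of graphs obtained by adding, to each member of $\mathscr{K}_{2,r}$, an edge between the two vertices of degree $r$. A messy ladder is a triple $(L,X,Y)$ consisting of a graph $L$ whose vertices all lie on two disjoint induced paths $X$ and $Y$ of $L$, called rails. Each rail is rooted at one of its endpoints, called its initial vertex; the other endpoint is called its terminal vertex. The graph $L$ has an edge $\sigma$ between the initial vertices of the two rails and an edge $\tau$ between the terminal vertices of the two rails. At most one of the rails may be trivial (a single vertex, which is then both initial and terminal). Edges of $L$ belonging to neither $X$ nor $Y$ are called rungs. The order of the messy ladder is the number of vertices of $L$. The graph $L$ itself is also called a messy ladder when such $X$ and $Y$ exist. On each rail write $u\le v$ if $u$ lies on the sub-path of the rail from its initial vertex to $v$, and $u<v$ if in addition $u\ne v$; for $a\le b$ on a rail, say $X$, $X[a,b]$ is the sub-path induced by the vertices $v$ with $a\le v\le b$. For a rung $e$, $e_X$ and $e_Y$ denote its endpoints on $X$ and $Y$. An ordered pair $(e,f)$ of rungs is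 a cross if $e_X<f_X$ and $f_Y<e_Y$; its $X$-span is $X[e_X,f_X]$ and its $Y$-span is $Y[f_Y,e_Y]$. A cross is degenerate if its $X$-span and its $Y$-span are both single edges. A clean ladder is a messy ladder all of whose crosses are degenerate. -}

module Defs where

open import Level using (0ℓ)
open import Data.Nat using (ℕ; suc; _<_)
import Data.Nat.Properties as ℕ
open import Data.Fin as Fin using (Fin; zero; toℕ; fromℕ)
import Data.Fin.Properties as Fin
open import Data.Fin.Subset using (Subset; _∈_; ∁; ∣_∣)
open import Data.Product using (Σ-syntax; ∃; ∃₂; _×_; _,_; proj₁; proj₂)
open import Data.Sum using (_⊎_; inj₁; inj₂)
open import Function using (_∘_; _⇔_; Injective)
open import Relation.Nullary using (¬_; yes; no)
open import Relation.Nullary.Decidable using (map′; _×-dec_; _⊎-dec_; ¬?)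
open import Relation.Binary using (Rel; Decidable; DecidableEquality; Symmetric; Irreflexive)
open import Relation.Binary.Construct.Closure.ReflexiveTransitive using (Star)
open import Relation.Binary.Construct.Closure.Symmetric using (SymClosure; fwd; bwd; symmetric)
open import Relation.Binary.PropositionalEquality using (_≡_; _≢_; refl; sym; ≢-sym)

-- Simple graphs with vertex type V.  Finiteness is a property of V: an
-- arbitrary finite graph is a Graph (Fin n), with n its order.  Adjacency is
-- decidable, as it is for a finite graph given by its adjacency matrix.
record Graph (V : Set) : Set₁ where
  infix 4 _~_ _~?_
  field
    _~_      : Rel V 0ℓ
    _~?_     : Decidable _~_
    ~-sym    : Symmetric _~_
    ~-irrefl : Irreflexive _≡_ _~_

-- An embedding of H into G is an isomorphism of H onto an induced subgraph of G.
infix 4 _↪_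
record _↪_ {V W : Set} (H : Graph V) (G : Graph W) : Set where
  private
    module H = Graph H
    module G = Graph G
  field
    map       : V → W
    injective : Injective _≡_ _≡_ map
    preserves : ∀ {u v} → u H.~ v → map u G.~ map v
    reflects  : ∀ {u v} → map u G.~ map v → u H.~ v

induced : ∀ {n} → Graph (Fin n) → (S : Subset n) → Graph (∃ λ v → v ∈ S)
induced G S = record
  { _~_      = λ u v → proj₁ u G.~ proj₁ v
  ; _~?_     = λ u v → proj₁ u G.~? proj₁ v
  ; ~-sym    = G.~-sym
  ; ~-irrefl = λ { refl → G.~-irrefl refl }
  }
  where module G = Graph G

Connected : {V : Set} → Graph V → Set
Connected {V} G = (u v : V) → Star (Graph._~_ G) u v

-- More than k vertices, and deleting fewer than k of them never disconnects.
IsConnected[_] : ℕ → ∀ {n} → Graph (Fin n) → Set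
IsConnected[ k ] {n} G =
  k < n × ((S : Subset n) → ∣ S ∣ < k → Connected (induced G (∁ S)))

complete : (n : ℕ) → Graph (Fin n)
complete n = record
  { _~_      = _≢_
  ; _~?_     = λ u v → ¬? (u Fin.≟ v)
  ; ~-sym    = ≢-sym
  ; ~-irrefl = λ eq neq → neq eq
  }

symGraph : {V : Set} (E : Rel V 0ℓ) → Decidable E → (∀ v → ¬ E v v) → Graph V
symGraph E E? E-irrefl = record
  { _~_      = SymClosure E
  ; _~?_     = λ u v → map′ (λ { (inj₁ e) → fwd e ; (inj₂ e) → bwd e })
                            (λ { (fwd e) → inj₁ e ; (bwd e) → inj₂ e })
                            (E? u v ⊎-dec E? v u)
  ; ~-sym    = symmetric E
  ; ~-irrefl = λ { refl (fwd e) → E-irrefl _ e ; refl (bwd e) → E-irrefl _ e }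
  }

path : (n : ℕ) → Graph (Fin n)
path n = symGraph (λ i j → toℕ j ≡ suc (toℕ i))
                  (λ i j → toℕ j ℕ.≟ suc (toℕ i))
                  (λ _ → ℕ.1+n≢n ∘ sym)

addEdge : {V : Set} → DecidableEquality V → Graph V → (a b : V) → a ≢ b → Graph V
addEdge _≟_ G a b a≢b =
  symGraph (λ u v → u G.~ v ⊎ (u ≡ a × v ≡ b))
           (λ u v → (u G.~? v) ⊎-dec ((u ≟ a) ×-dec (v ≟ b)))
           (λ { _ (inj₁ e) → G.~-irrefl refl e ; _ (inj₂ (refl , eq)) → a≢b eq })
  where module G = Graph G

-- Subdivisions of K_{2,r}, whose parts are the `hub i` and the `mid j`.  The
-- edge {hub i, mid j} is subdivided s i j times, that is, it is replaced by
-- the path  hub i, new i j 0, …, new i j (s i j − 1), mid j.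
module _ {r : ℕ} (s : Fin 2 → Fin r → ℕ) where

  data SubV : Set where
    hub : Fin 2 → SubV
    mid : Fin r → SubV
    new : (i : Fin 2) (j : Fin r) → Fin (s i j) → SubV

  data SubE : SubV → SubV → Set where
    whole : ∀ {i j} → s i j ≡ 0 → SubE (hub i) (mid j)
    first : ∀ {i j k} → toℕ k ≡ 0 → SubE (hub i) (new i j k)
    inner : ∀ {i j k l} → toℕ l ≡ suc (toℕ k) → SubE (new i j k) (new i j l)
    last  : ∀ {i j k} → suc (toℕ k) ≡ s i j → SubE (new i j k) (mid j)

  SubE-irrefl : ∀ v → ¬ SubE v v
  SubE-irrefl (new i j k) (inner eq) = ℕ.1+n≢n (sym eq)

  SubE? : Decidable SubE
  SubE? (hub i) (hub _) = no λ ()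
  SubE? (hub i) (mid j) = map′ whole (λ { (whole p) → p }) (s i j ℕ.≟ 0)
  SubE? (hub i) (new i′ j k) with i Fin.≟ i′
  ... | no i≢i′  = no λ { (first _) → i≢i′ refl }
  ... | yes refl = map′ first (λ { (first p) → p }) (toℕ k ℕ.≟ 0)
  SubE? (mid _) _ = no λ ()
  SubE? (new i j k) (hub _) = no λ ()
  SubE? (new i j k) (mid j′) with j Fin.≟ j′
  ... | no j≢j′  = no λ { (last _) → j≢j′ refl }
  ... | yes refl = map′ last (λ { (last p) → p }) (suc (toℕ k) ℕ.≟ s i j)
  SubE? (new i j k) (new i′ j′ l) with i Fin.≟ i′ | j Fin.≟ j′
  ... | no i≢i′  | _        = no λ { (inner _) → i≢i′ refl }
  ... | yes _    | no j≢j′  = no λ { (inner _) → j≢j′ refl }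
  ... | yes refl | yes refl = map′ inner (λ { (inner p) → p }) (toℕ l ℕ.≟ suc (toℕ k))

  _≟SubV_ : DecidableEquality SubV
  hub i ≟SubV hub i′ = map′ (λ { refl → refl }) (λ { refl → refl }) (i Fin.≟ i′)
  hub _ ≟SubV mid _ = no λ ()
  hub _ ≟SubV new _ _ _ = no λ ()
  mid _ ≟SubV hub _ = no λ ()
  mid j ≟SubV mid j′ = map′ (λ { refl → refl }) (λ { refl → refl }) (j Fin.≟ j′)
  mid _ ≟SubV new _ _ _ = no λ ()
  new _ _ _ ≟SubV hub _ = no λ ()
  new _ _ _ ≟SubV mid _ = no λ ()
  new i j k ≟SubV new i′ j′ k′ with i Fin.≟ i′ | j Fin.≟ j′
  ... | no i≢i′  | _        = no λ { refl → i≢i′ refl }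
  ... | yes _    | no j≢j′  = no λ { refl → j≢j′ refl }
  ... | yes refl | yes refl = map′ (λ { refl → refl }) (λ { refl → refl }) (k Fin.≟ k′)

  subdividedK₂ : Graph SubV
  subdividedK₂ = symGraph SubE SubE? SubE-irrefl

  -- For r > 2 the hubs are exactly the two vertices of degree r: every other
  -- vertex has degree 2.
  subdividedK₂⁺ : Graph SubV
  subdividedK₂⁺ =
    addEdge _≟SubV_ subdividedK₂ (hub zero) (hub (Fin.suc zero)) λ ()

-- A rail, being an induced path rooted at one of its ends, is an embedding of
-- a path, with position zero the initial vertex.  Rails have m + 1 and n + 1
-- vertices, so m ≡ 0 means that X is trivial.
record MessyLadder {V : Set} (L : Graph V) : Set where
  open Graph L
  field
    {m n} : ℕ
    X     : path (suc m) ↪ L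
    Y     : path (suc n) ↪ L

  x : Fin (suc m) → V
  x = _↪_.map X
  y : Fin (suc n) → V
  y = _↪_.map Y

  field
    disjoint    : ∀ i j → x i ≢ y j
    covering    : ∀ v → (∃ λ i → x i ≡ v) ⊎ (∃ λ j → y j ≡ v)
    σ           : x zero ~ y zero
    τ           : x (fromℕ m) ~ y (fromℕ n)
    not-trivial : ¬ (m ≡ 0 × n ≡ 0)

  -- The rails are induced and cover L, so the edges in neither rail are those
  -- joining X to Y.  A rung is recorded by the positions of its ends.
  record Rung : Set where
    constructor rung
    field
      endX : Fin (suc m)
      endY : Fin (suc n)
      edge : x endX ~ y endY
  open Rung public

  Cross : Rung → Rung → Set
  Cross e f = endX e Fin.< endX f × endY f Fin.< endY e

  X[_,_] : Fin (suc m) → Fin (suc m) → V → Set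
  X[ a , b ] v = ∃ λ i → a Fin.≤ i × i Fin.≤ b × x i ≡ v

  Y[_,_] : Fin (suc n) → Fin (suc n) → V → Set
  Y[ a , b ] v = ∃ λ j → a Fin.≤ j × j Fin.≤ b × y j ≡ v

  -- The subgraph of L induced by the vertices in P is a single edge.
  SingleEdge : (V → Set) → Set
  SingleEdge P = ∃₂ λ u v → u ~ v × (∀ w → P w ⇔ (w ≡ u ⊎ w ≡ v))

  Degenerate : Rung → Rung → Set
  Degenerate e f =
    SingleEdge X[ endX e , endX f ] × SingleEdge Y[ endY f , endY e ]

IsCleanLadder : {V : Set} → Graph V → Set
IsCleanLadder L = Σ[ M ∈ MessyLadder L ] (let open MessyLadder M in
  (e f : Rung) → Cross e f → Degenerate e f)

{-# OPTIONS --safe #-}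
module Submission where

-- Among the pairs of disjoint induced paths joining two given edges, swapping the tails of the two
-- paths at a nondegenerate cross shortens their total length; so in a 2-connected graph without
-- clean ladders of order r any two vertices are joined by an induced path of length at most r.
-- Given many such paths from one root to distinct ends, Ramsey's theorem makes the pattern of
-- coincidences and adjacencies between positions on them uniform.  If two positions always coincide,
-- all paths but one pass through a common vertex: restart from there with shorter paths.  If two
-- positions a, b are always adjacent, either one of the two rows of vertices is a clique, or two
-- vertices of row a with many of row b induce a K_{2,r}.  Otherwise the paths form a spider: they are
-- disjoint and nonadjacent apart from their root.
--
-- The paths from one vertex to all others thus yield a vertex w of large degree.  An induced path
-- avoiding w between two neighbours of w is the rail of a ladder whose other rail is w alone, so it
-- is short as well; the spider found among such paths, cut at the first neighbours of w, is a
-- subdivision of K_{2,r} with w as its second hub.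

open import Defs
open import Data.Empty using (⊥-elim)
open import Data.Fin as Fin using (Fin; zero; suc; toℕ; fromℕ; fromℕ<; _↑ˡ_; _↑ʳ_; splitAt)
import Data.Fin.Properties as Fin
open import Data.Fin.Subset using (∁; ⁅_⁆; _∈_)
open import Data.Fin.Subset.Properties using (∣⁅x⁆∣≡1; x∉p⇒x∈∁p; x∈∁p⇒x∉p; x∈⁅x⁆; x∈⁅y⁆⇒x≡y)
open import Data.List using (List; []; _∷_; length; filter; map; upTo; allFin; cartesianProduct) renaming (_++_ to _++ₗ_)
open import Data.List.Membership.Propositional.Properties using (∈-cartesianProduct⁺; ∈-upTo⁺)
open import Data.List.Properties using (length-map; length-tabulate)
open import Data.List.Relation.Binary.Sublist.Propositional using (_⊆_; _∷_; _∷ʳ_; []; ⊆-refl; ⊆-trans; minimum)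
open import Data.List.Relation.Binary.Sublist.Propositional.Properties using (All-resp-⊆; filter-⊆)
open import Data.List.Relation.Unary.All as All using (All; []; _∷_)
import Data.List.Relation.Unary.All.Properties as All
open import Data.List.Relation.Unary.AllPairs as AllPairs using (AllPairs; []; _∷_)
import Data.List.Relation.Unary.AllPairs.Properties as AllPairs
open import Data.List.Relation.Unary.Unique.Propositional.Properties using (allFin⁺)
open import Data.Nat
open import Data.Nat.Properties
open import Data.Nat.Tactic.RingSolver using (solve-∀)
open import Data.Product using (Σ-syntax; ∃; _×_; _,_; proj₁; proj₂; uncurry)
open import Data.Sum as Sum using (_⊎_; inj₁; inj₂; [_,_]′)
open import Data.Unit using (⊤; tt)
open import Function using (_∘_; _⇔_; mk⇔)
open import Level using (Level; 0ℓ)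
open import Relation.Binary using (Rel; Decidable; Symmetric; tri<; tri≈; tri>)
open import Relation.Binary.Construct.Closure.ReflexiveTransitive using (Star; ε; _◅_)
open import Relation.Binary.Construct.Closure.Symmetric using (SymClosure; fwd; bwd; symmetric)
open import Relation.Binary.PropositionalEquality
open import Relation.Nullary using (¬_; Dec; yes; no; contradiction)
open import Relation.Nullary.Decidable using (_⊎-dec_; _×-dec_; ¬?; decidable-stable; map′)
import Relation.Unary as U

-- Ramsey's theorem for lists

AllPairs-resp-⊆ : ∀ {A : Set} {R : Rel A 0ℓ} {xs ys} → xs ⊆ ys → AllPairs R ys → AllPairs R xs
AllPairs-resp-⊆ []           []         = []
AllPairs-resp-⊆ (_ ∷ʳ τ)     (_ ∷ rs)   = AllPairs-resp-⊆ τ rs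
AllPairs-resp-⊆ (refl ∷ τ)   (r ∷ rs)   = All-resp-⊆ τ r ∷ AllPairs-resp-⊆ τ rs

length-filter+length-filter-¬ : ∀ {A : Set} {P : U.Pred A 0ℓ} (P? : U.Decidable P) xs →
  length xs ≡ length (filter P? xs) + length (filter (¬? ∘ P?) xs)
length-filter+length-filter-¬ P? [] = refl
length-filter+length-filter-¬ P? (x ∷ xs) with P? x
... | yes _ = cong suc (length-filter+length-filter-¬ P? xs)
... | no  _ = trans (cong suc (length-filter+length-filter-¬ P? xs)) (sym (+-suc _ _))

Total Empty : ∀ {A : Set} → Rel A 0ℓ → List A → Set
Total R = AllPairs R
Empty R = AllPairs (λ x y → ¬ R x y)

-- The recursion mirrors the proof: the `suc` is the head of the list, and the two summands are what
-- its related and its unrelated successors must reach.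
ramsey : ℕ → ℕ → ℕ
ramsey zero    t       = 0
ramsey (suc s) zero    = 0
ramsey (suc s) (suc t) = suc (ramsey s (suc t) + ramsey (suc s) t)

m+n≤o+p⇒m≤o⊎n≤p : ∀ {m n o p} → m + n ≤ o + p → m ≤ o ⊎ n ≤ p
m+n≤o+p⇒m≤o⊎n≤p {m} {n} {o} {p} le with m ≤? o | n ≤? p
... | yes m≤o | _       = inj₁ m≤o
... | _       | yes n≤p = inj₂ n≤p
... | no m≰o  | no n≰p  = inj₁ (contradict (<-≤-trans (+-mono-< (≰⇒> m≰o) (≰⇒> n≰p)) le))
  where
  contradict : o + p < o + p → m ≤ o
  contradict lt with () ← <-irrefl refl lt

module _ {A : Set} {R : Rel A 0ℓ} (R? : Decidable R) where

  -- The head is compared only with later entries, and `AllPairs` asks for no more, so `R` may be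
  -- asymmetric. This matters for relations between different positions on two paths.
  ramsey-theorem : ∀ s t (xs : List A) → ramsey s t ≤ length xs →
    (∃ λ ys → ys ⊆ xs × s ≤ length ys × Total R ys) ⊎
    (∃ λ ys → ys ⊆ xs × t ≤ length ys × Empty R ys)
  ramsey-theorem zero    t       xs le = inj₁ ([] , minimum xs , z≤n , [])
  ramsey-theorem (suc s) zero    xs le = inj₂ ([] , minimum xs , z≤n , [])
  ramsey-theorem (suc s) (suc t) (x ∷ xs) (s≤s le)
    with m+n≤o+p⇒m≤o⊎n≤p (subst (_ ≤_) (length-filter+length-filter-¬ (R? x) xs) le)
  ... | inj₁ le₁ with ramsey-theorem s (suc t) (filter (R? x) xs) le₁
  ...   | inj₁ (ys , τ , s≤ , rs) = inj₁
          (x ∷ ys , refl ∷ ⊆-trans τ (filter-⊆ (R? x) xs) , s≤s s≤ ,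
           All-resp-⊆ τ (All.all-filter (R? x) xs) ∷ rs)
  ...   | inj₂ (ys , τ , t≤ , rs) = inj₂
          (ys , x ∷ʳ ⊆-trans τ (filter-⊆ (R? x) xs) , t≤ , rs)
  ramsey-theorem (suc s) (suc t) (x ∷ xs) (s≤s le) | inj₂ le₂
    with ramsey-theorem (suc s) t (filter (¬? ∘ R? x) xs) le₂
  ...   | inj₁ (ys , τ , s≤ , rs) = inj₁
          (ys , x ∷ʳ ⊆-trans τ (filter-⊆ (¬? ∘ R? x) xs) , s≤ , rs)
  ...   | inj₂ (ys , τ , t≤ , rs) = inj₂
          (x ∷ ys , refl ∷ ⊆-trans τ (filter-⊆ (¬? ∘ R? x) xs) , s≤s t≤ ,
           All-resp-⊆ τ (All.all-filter (¬? ∘ R? x) xs) ∷ rs)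

homogeneousSize : ℕ → ℕ → ℕ
homogeneousSize zero    m = m
homogeneousSize (suc c) m = ramsey (homogeneousSize c m) (homogeneousSize c m)

Homogeneous : ∀ {A : Set} → Rel A 0ℓ → List A → Set
Homogeneous R xs = Total R xs ⊎ Empty R xs

module _ {A I : Set} {R : I → Rel A 0ℓ} (R? : ∀ i → Decidable (R i)) where

  -- Homogeneity passes to sublists, so the relations are treated one after another, each inside the
  -- sublist left by the earlier ones.
  homogenise : ∀ m (is : List I) (xs : List A) → homogeneousSize (length is) m ≤ length xs →
    ∃ λ ys → ys ⊆ xs × m ≤ length ys × All (λ i → Homogeneous (R i) ys) is
  homogenise m []       xs le = xs , ⊆-refl , le , []
  homogenise m (i ∷ is) xs le with ramsey-theorem (R? i) (homogeneousSize (length is) m) (homogeneousSize (length is) m) xs le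
  ... | inj₁ (ys , τ , le′ , hom) with zs , τ′ , m≤ , homs ← homogenise m is ys le′ =
        zs , ⊆-trans τ′ τ , m≤ , inj₁ (AllPairs-resp-⊆ τ′ hom) ∷ homs
  ... | inj₂ (ys , τ , le′ , hom) with zs , τ′ , m≤ , homs ← homogenise m is ys le′ =
        zs , ⊆-trans τ′ τ , m≤ , inj₂ (AllPairs-resp-⊆ τ′ hom) ∷ homs

select : ∀ {A : Set} {P : A → Set} {R : Rel A 0ℓ} {m} {xs : List A} →
  m ≤ length xs → All P xs → AllPairs R xs →
  Σ[ f ∈ (Fin m → A) ] (∀ i → P (f i)) × (∀ {i j} → i Fin.< j → R (f i) (f j))
select {m = zero} _ _ _ = (λ ()) , (λ ()) , λ {}
select {A} {P} {R} {suc m} (s≤s m≤) (p ∷ ps) (r ∷ rs)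
  with f , pf , rf ← select m≤ (All.zip (ps , r)) rs = g , pg , rg
  where
  g : Fin (suc m) → A
  g zero    = _
  g (suc i) = f i
  pg : ∀ i → P (g i)
  pg zero    = p
  pg (suc i) = proj₁ (pf i)
  rg : ∀ {i j} → i Fin.< j → R (g i) (g j)
  rg {zero}  {suc j} _         = proj₂ (pf j)
  rg {suc i} {suc j} (s≤s i<j) = rf i<j

-- Walks and induced paths

findLast : {P : ℕ → Set} → U.Decidable P → ∀ n →
  (∃ λ i → i ≤ n × P i × (∀ {j} → i < j → j ≤ n → ¬ P j)) ⊎ (∀ {j} → j ≤ n → ¬ P j)
findLast P? n with P? n
... | yes p = inj₁ (n , ≤-refl , p , λ n<j j≤n _ → <-irrefl refl (<-≤-trans n<j j≤n))
findLast P? zero | no ¬p = inj₂ λ { z≤n → ¬p }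
findLast {P} P? (suc n) | no ¬p with findLast P? n
... | inj₁ (i , i≤n , p , later) = inj₁ (i , m≤n⇒m≤1+n i≤n , p , later′)
  where
  later′ : ∀ {j} → i < j → j ≤ suc n → ¬ P j
  later′ i<j j≤ with m≤n⇒m<n∨m≡n j≤
  ... | inj₁ (s≤s j≤n) = later i<j j≤n
  ... | inj₂ refl      = ¬p
... | inj₂ none = inj₂ none′
  where
  none′ : ∀ {j} → j ≤ suc n → ¬ P j
  none′ j≤ with m≤n⇒m<n∨m≡n j≤
  ... | inj₁ (s≤s j≤n) = none j≤n
  ... | inj₂ refl      = ¬p

module Paths {n} (G : Graph (Fin n)) where
  open Graph G

  -- With `P` in the type, control over the vertices survives gluing and shortcutting; disjointness
  -- of two walks becomes incompatibility of their predicates.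
  data Walk (P : Fin n → Set) : Fin n → Fin n → ℕ → Set where
    [_]  : ∀ {x} → P x → Walk P x x 0
    step : ∀ {x y z k} → P x → x ~ y → Walk P y z k → Walk P x z (suc k)

  mapWalk : ∀ {P Q : Fin n → Set} → (∀ {v} → P v → Q v) → ∀ {x y k} → Walk P x y k → Walk Q x y k
  mapWalk f [ p ]        = [ f p ]
  mapWalk f (step p e w) = step (f p) e (mapWalk f w)

  infixr 5 _++[_]++_
  _++[_]++_ : ∀ {P x y x′ y′ k l} → Walk P x y k → y ~ x′ → Walk P x′ y′ l → Walk P x y′ (suc (k + l))
  [ p ]       ++[ e ]++ w′ = step p e w′
  step p e′ w ++[ e ]++ w′ = step p e′ (w ++[ e ]++ w′)

  infixr 5 _++_
  _++_ : ∀ {P x y z k l} → Walk P x y k → Walk P y z l → Walk P x z (k + l)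
  [ p ]      ++ w′ = w′
  step p e w ++ w′ = step p e (w ++ w′)

  -- An induced path. Positions are natural numbers, so that a prefix keeps `at` and a suffix merely
  -- shifts it; values of `at` beyond `len` carry no meaning.
  record Path (x y : Fin n) : Set where
    field
      len       : ℕ
      at        : ℕ → Fin n
      source    : at 0 ≡ x
      target    : at len ≡ y
      edge      : ∀ {i} → i < len → at i ~ at (suc i)
      injective : ∀ {i j} → i < j → j ≤ len → at i ≢ at j
      chordless : ∀ {i j} → i < j → j ≤ len → at i ~ at j → j ≡ suc i

    On : Fin n → Set
    On v = ∃ λ i → i ≤ len × at i ≡ v

    on : ∀ {i} → i ≤ len → On (at i)
    on i≤ = _ , i≤ , refl

    source-on : On x
    source-on = 0 , z≤n , source

    target-on : On y
    target-on = len , ≤-refl , target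

    at-injective : ∀ {i j} → i ≤ len → j ≤ len → at i ≡ at j → i ≡ j
    at-injective {i} {j} i≤ j≤ eq with <-cmp i j
    ... | tri< i<j _ _ = contradiction eq (injective i<j j≤)
    ... | tri≈ _ i≡j _ = i≡j
    ... | tri> _ _ j<i = contradiction (sym eq) (injective j<i i≤)

    toWalk : Walk On x y len
    toWalk = subst (λ v → Walk On v y len) source (from 0 len refl)
      where
      from : ∀ i k → i + k ≡ len → Walk On (at i) y k
      from i zero    eq = subst (λ v → Walk On (at i) v 0) (trans (cong at i≡len) target) [ on (≤-reflexive i≡len) ]
        where i≡len = trans (sym (+-identityʳ i)) eq
      from i (suc k) eq = step (on (<⇒≤ i<len)) (edge i<len) (from (suc i) k (trans (sym (+-suc i k)) eq))
        where i<len = subst (i <_) eq (m<m+n i (s≤s z≤n))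

    prefix : ∀ i → i ≤ len → Path x (at i)
    prefix i i≤ = record
      { len = i ; at = at ; source = source ; target = refl
      ; edge = λ lt → edge (<-≤-trans lt i≤)
      ; injective = λ lt le → injective lt (≤-trans le i≤)
      ; chordless = λ lt le → chordless lt (≤-trans le i≤)
      }

    suffix : ∀ j → j ≤ len → Path (at j) y
    suffix j j≤ = record
      { len = len ∸ j ; at = λ i → at (i + j) ; source = refl
      ; target = trans (cong at (m∸n+n≡m j≤)) target
      ; edge = λ lt → edge (m≤o∸n⇒m+n≤o _ j≤ lt)
      ; injective = λ lt le → injective (+-monoˡ-< j lt) (m≤o∸n⇒m+n≤o _ j≤ le)
      ; chordless = λ lt le e → +-cancelʳ-≡ j _ _ (chordless (+-monoˡ-< j lt) (m≤o∸n⇒m+n≤o _ j≤ le) e)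
      }

  open Path public using (len; at)

  Inside : (Fin n → Set) → ∀ {x y} → Path x y → Set
  Inside P p = ∀ {i} → i ≤ len p → P (at p i)

  suffix-inside : ∀ {P x y} (p : Path x y) {j} (j≤ : j ≤ len p) → Inside P p → Inside P (Path.suffix p j j≤)
  suffix-inside p j≤ P⊇p le = P⊇p (m≤o∸n⇒m+n≤o _ j≤ le)

  trivial : ∀ x → Path x x
  trivial x = record
    { len = 0 ; at = λ _ → x ; source = refl ; target = refl ; edge = λ ()
    ; injective = λ { (s≤s _) () } ; chordless = λ { (s≤s _) () } }

  cons : ∀ {x y z} (p : Path y z) → x ~ y → (∀ {i} → i ≤ len p → x ≢ at p i) →
         (∀ {i} → 0 < i → i ≤ len p → ¬ x ~ at p i) → Path x z
  cons {x} p e x∉p nonadj = record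
    { len = suc (len p) ; at = at′ ; source = refl ; target = Path.target p
    ; edge = edge′ ; injective = inj′ ; chordless = chord′ }
    where
    at′ : ℕ → Fin n
    at′ zero    = x
    at′ (suc i) = at p i
    edge′ : ∀ {i} → i < suc (len p) → at′ i ~ at′ (suc i)
    edge′ {zero}  _        = subst (x ~_) (sym (Path.source p)) e
    edge′ {suc i} (s≤s lt) = Path.edge p lt
    inj′ : ∀ {i j} → i < j → j ≤ suc (len p) → at′ i ≢ at′ j
    inj′ {zero}  (s≤s _)  (s≤s le) = x∉p le
    inj′ {suc i} (s≤s lt) (s≤s le) = Path.injective p lt le
    chord′ : ∀ {i j} → i < j → j ≤ suc (len p) → at′ i ~ at′ j → j ≡ suc i
    chord′ {zero}  {suc zero}    _        _        _  = refl
    chord′ {zero}  {suc (suc j)} _        (s≤s le) e′ = contradiction e′ (nonadj (s≤s z≤n) le)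
    chord′ {suc i} (s≤s lt) (s≤s le) e′ = cong suc (Path.chordless p lt le e′)

  cons-inside : ∀ {P x y z} (p : Path y z) (e : x ~ y) (x∉p : ∀ {i} → i ≤ len p → x ≢ at p i)
                (nonadj : ∀ {i} → 0 < i → i ≤ len p → ¬ x ~ at p i) →
                P x → Inside P p → Inside P (cons p e x∉p nonadj)
  cons-inside p e x∉p nonadj px P⊇p {zero}  le       = px
  cons-inside p e x∉p nonadj px P⊇p {suc i} (s≤s le) = P⊇p le

  -- The new first vertex is joined to the last vertex of the path that it equals or sees.
  induce : ∀ {P x y k} → Walk P x y k → Σ[ p ∈ Path x y ] len p ≤ k × Inside P p
  induce {x = x} [ px ] = trivial x , z≤n , λ _ → px
  induce {P} {x} {z} {suc k} (step px e w) with induce w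
  ... | p , p≤ , P⊇p with findLast (λ i → (x Fin.≟ at p i) ⊎-dec (x ~? at p i)) (len p)
  ...   | inj₁ (i , i≤ , inj₁ refl , _) = Path.suffix p i i≤ , ≤-trans (m∸n≤m _ i) (m≤n⇒m≤1+n p≤) , suffix-inside {P = P} p i≤ P⊇p
  ...   | inj₁ (i , i≤ , inj₂ e′ , later) with x Fin.≟ at p i
  ...     | yes refl = contradiction e′ (~-irrefl refl)
  ...     | no x≢ = cons q e′ x∉q nonadj , s≤s (≤-trans (m∸n≤m _ i) p≤) , cons-inside q e′ x∉q nonadj px (suffix-inside {P = P} p i≤ P⊇p)
    where
    q = Path.suffix p i i≤
    x∉q : ∀ {j} → j ≤ len q → x ≢ at q j
    x∉q {zero}  _  = x≢
    x∉q {suc j} le eq = later (s≤s (m≤n+m i j)) (m≤o∸n⇒m+n≤o _ i≤ le) (inj₁ eq)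
    nonadj : ∀ {j} → 0 < j → j ≤ len q → ¬ x ~ at q j
    nonadj {suc j} _ le eq = later (s≤s (m≤n+m i j)) (m≤o∸n⇒m+n≤o _ i≤ le) (inj₂ eq)
  induce {x = x} (step px e w) | p , p≤ , P⊇p | inj₂ none =
    ⊥-elim (none z≤n (inj₂ (subst (x ~_) (sym (Path.source p)) e)))

-- Clean ladders

-- For injective `f` this is the subgraph induced on the image of `f`, with renamed vertices. It
-- turns a ladder found inside `G` into a graph on some `Fin k`.
pullback : ∀ {V W : Set} → Graph W → (V → W) → Graph V
pullback G f = record
  { _~_ = λ u v → f u ~ f v ; _~?_ = λ u v → f u ~? f v ; ~-sym = ~-sym
  ; ~-irrefl = λ { refl → ~-irrefl refl } }
  where open Graph G

pullback-↪ : ∀ {V W : Set} (G : Graph W) {f : V → W} → (∀ {u v} → f u ≡ f v → u ≡ v) → pullback G f ↪ G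
pullback-↪ G {f} inj = record { map = f ; injective = inj ; preserves = λ e → e ; reflects = λ e → e }

-- The path lengths are A + j and B + d; swapping the tails after i < j and c < d leaves the
-- tails of lengths B and A, joined to the heads by one edge each.
swap-shortens : ∀ {i j c d} A B → i < j → c < d → ¬ (j ≡ suc i × d ≡ suc c) →
  suc (i + B) + suc (c + A) < (A + j) + (B + d)
swap-shortens {i} {j} {c} {d} A B i<j c<d nondegenerate =
  subst₂ _≤_ (lhs i c A B) (rhs j d A B) (+-monoˡ-≤ (A + B) core)
  where
  core : suc (suc i + suc c) ≤ j + d
  core with m≤n⇒m<n∨m≡n i<j | m≤n⇒m<n∨m≡n c<d
  ... | inj₁ lt   | _         = +-mono-≤ lt c<d
  ... | inj₂ refl | inj₁ lt   = subst (_≤ suc i + d) (+-suc (suc i) (suc c)) (+-monoʳ-≤ (suc i) lt)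
  ... | inj₂ refl | inj₂ refl = contradiction (refl , refl) nondegenerate
  lhs : ∀ i c A B → suc (suc i + suc c) + (A + B) ≡ suc (suc (i + B) + suc (c + A))
  lhs = solve-∀
  rhs : ∀ j d A B → j + d + (A + B) ≡ (A + j) + (B + d)
  rhs = solve-∀

single-edge : ∀ {V : Set} {H : Graph V} {m} (X : path m ↪ H) → let open Graph H; x = _↪_.map X in
  ∀ {i j} → toℕ j ≡ suc (toℕ i) →
  Σ[ u ∈ V ] Σ[ v ∈ V ] u ~ v × (∀ w → (∃ λ k → i Fin.≤ k × k Fin.≤ j × x k ≡ w) ⇔ (w ≡ u ⊎ w ≡ v))
single-edge X {i} {j} eq = x i , x j , _↪_.preserves X (fwd eq) , λ w → mk⇔ to from
  where
  x = _↪_.map X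
  i≤j : i Fin.≤ j
  i≤j = subst (toℕ i ≤_) (sym eq) (n≤1+n _)
  to : ∀ {w} → (∃ λ k → i Fin.≤ k × k Fin.≤ j × x k ≡ w) → w ≡ x i ⊎ w ≡ x j
  to (k , i≤k , k≤j , refl) with m≤n⇒m<n∨m≡n i≤k
  ... | inj₁ i<k = inj₂ (cong x (Fin.toℕ-injective (≤-antisym k≤j (subst (_≤ toℕ k) (sym eq) i<k))))
  ... | inj₂ i≡k = inj₁ (cong x (Fin.toℕ-injective (sym i≡k)))
  from : ∀ {w} → w ≡ x i ⊎ w ≡ x j → ∃ λ k → i Fin.≤ k × k Fin.≤ j × x k ≡ w
  from (inj₁ refl) = i , ≤-refl , i≤j , refl
  from (inj₂ refl) = j , i≤j , ≤-refl , refl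

module Ladders {n} (G : Graph (Fin n)) where
  open Graph G
  open Paths G

  -- If `a ~ a′` and `b ~ b′`, the two paths are the rails of a messy ladder, and `Clean` is the
  -- condition on its crosses. `size` counts the edges of the rails.
  record Link (a a′ b b′ : Fin n) : Set where
    field
      p        : Path a b
      q        : Path a′ b′
      disjoint : ∀ {i j} → i ≤ len p → j ≤ len q → at p i ≢ at q j

    size : ℕ
    size = len p + len q

    Clean : Set
    Clean = ∀ {i j c d} → i < j → j ≤ len p → c < d → d ≤ len q →
            at p i ~ at q d → at p j ~ at q c → j ≡ suc i × d ≡ suc c

  open Link

  link : ∀ {P Q a a′ b b′ k l} → Walk P a b k → Walk Q a′ b′ l → (∀ {v} → P v → ¬ Q v) →
         Σ[ L ∈ Link a a′ b b′ ] size L ≤ k + l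
  link {Q = Q} w w′ P∩Q=∅ with induce w | induce w′
  ... | p , p≤ , P⊇p | q , q≤ , Q⊇q = record
    { p = p ; q = q
    ; disjoint = λ i≤ j≤ eq → P∩Q=∅ (P⊇p i≤) (subst Q (sym eq) (Q⊇q j≤)) } , +-mono-≤ p≤ q≤

  -- One new walk follows `p` to position `i` and then `q` from position `d`, the other follows `q`
  -- to `c` and then `p` from `j`. They are disjoint because `i < j` and `c < d`, and they end with
  -- the targets exchanged. Making them induced never lengthens them.
  uncross : ∀ {a a′ b b′} (L : Link a a′ b b′) {i j c d} →
    i < j → j ≤ len (p L) → c < d → d ≤ len (q L) → at (p L) i ~ at (q L) d → at (p L) j ~ at (q L) c →
    ¬ (j ≡ suc i × d ≡ suc c) → Σ[ L′ ∈ Link a a′ b′ b ] size L′ < size L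
  uncross {a} {a′} {b} {b′} L {i} {j} {c} {d} i<j j≤ c<d d≤ e f nondegenerate =
    proj₁ L′ , ≤-<-trans (proj₂ L′)
      (subst₂ (λ x y → suc (i + (len (q L) ∸ d)) + suc (c + (len (p L) ∸ j)) < x + y) (m∸n+n≡m j≤) (m∸n+n≡m d≤)
        (swap-shortens (len (p L) ∸ j) (len (q L) ∸ d) i<j c<d nondegenerate))
    where
    i≤ = ≤-trans (<⇒≤ i<j) j≤
    c≤ = ≤-trans (<⇒≤ c<d) d≤
    p₁ = Path.prefix (p L) i i≤
    p₂ = Path.suffix (p L) j j≤
    q₁ = Path.prefix (q L) c c≤
    q₂ = Path.suffix (q L) d d≤
    apart : ∀ {v} → Path.On p₁ v ⊎ Path.On q₂ v → ¬ (Path.On q₁ v ⊎ Path.On p₂ v)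
    apart (inj₁ (s , s≤ , refl)) (inj₁ (t , t≤ , eq)) = disjoint L (≤-trans s≤ i≤) (≤-trans t≤ c≤) (sym eq)
    apart (inj₁ (s , s≤ , refl)) (inj₂ (t , t≤ , eq)) =
      Path.injective (p L) (<-≤-trans (s≤s s≤) (≤-trans i<j (m≤n+m j t))) (m≤o∸n⇒m+n≤o t j≤ t≤) (sym eq)
    apart (inj₂ (s , s≤ , refl)) (inj₁ (t , t≤ , eq)) =
      Path.injective (q L) (<-≤-trans (s≤s t≤) (≤-trans c<d (m≤n+m d s))) (m≤o∸n⇒m+n≤o s d≤ s≤) eq
    apart (inj₂ (s , s≤ , refl)) (inj₂ (t , t≤ , eq)) =
      disjoint L (m≤o∸n⇒m+n≤o t j≤ t≤) (m≤o∸n⇒m+n≤o s d≤ s≤) eq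
    L′ = link (mapWalk inj₁ (Path.toWalk p₁) ++[ e ]++ mapWalk inj₂ (Path.toWalk q₂))
              (mapWalk inj₁ (Path.toWalk q₁) ++[ ~-sym f ]++ mapWalk inj₂ (Path.toWalk p₂)) apart

  -- A nondegenerate cross, with positions in `Fin` so that its existence can be decided by
  -- exhaustive search.
  Crossing : ∀ {a a′ b b′} (L : Link a a′ b b′) → (i j : Fin (suc (len (p L)))) (c d : Fin (suc (len (q L)))) → Set
  Crossing L i j c d = i Fin.< j × c Fin.< d × at (p L) (toℕ i) ~ at (q L) (toℕ d) × at (p L) (toℕ j) ~ at (q L) (toℕ c) ×
    ¬ (toℕ j ≡ suc (toℕ i) × toℕ d ≡ suc (toℕ c))

  crossing? : ∀ {a a′ b b′} (L : Link a a′ b b′) → Dec (∃ λ i → ∃ λ j → ∃ λ c → ∃ λ d → Crossing L i j c d)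
  crossing? L = Fin.any? λ i → Fin.any? λ j → Fin.any? λ c → Fin.any? λ d →
    (i Fin.<? j) ×-dec (c Fin.<? d) ×-dec (_ ~? _) ×-dec (_ ~? _) ×-dec
    ¬? ((toℕ j ≟ suc (toℕ i)) ×-dec (toℕ d ≟ suc (toℕ c)))

  -- Uncrossing lowers the size, so it stops, at a clean link. Each round exchanges the targets,
  -- hence the two possible outcomes.
  clean : ∀ {a a′ b b′} N (L : Link a a′ b b′) → size L < N →
    (Σ[ M ∈ Link a a′ b b′ ] Clean M) ⊎ (Σ[ M ∈ Link a a′ b′ b ] Clean M)
  clean (suc N) L (s≤s size≤) with crossing? L
  ... | yes (i , j , c , d , i<j , c<d , e , f , nondegenerate) =
    let L′ , L′< = uncross L i<j (s≤s⁻¹ (Fin.toℕ<n j)) c<d (s≤s⁻¹ (Fin.toℕ<n d)) e f nondegenerate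
    in Sum.swap (clean N L′ (<-≤-trans L′< size≤))
  ... | no none = inj₁ (L , clean-L)
    where
    clean-L : Clean L
    clean-L {i} {j} {c} {d} i<j j≤ c<d d≤ e f = decidable-stable (j ≟ suc i ×-dec d ≟ suc c) λ nondegenerate →
      none (_ , _ , _ , _ , crossing (bound (≤-trans (<⇒≤ i<j) j≤)) (bound j≤) (bound (≤-trans (<⇒≤ c<d) d≤)) (bound d≤) nondegenerate)
      where
      bound : ∀ {k l} → k ≤ l → Σ[ x ∈ Fin (suc l) ] toℕ x ≡ k
      bound k≤ = fromℕ< (s≤s k≤) , Fin.toℕ-fromℕ< (s≤s k≤)
      crossing : (i′ : Σ[ x ∈ Fin _ ] toℕ x ≡ i) (j′ : Σ[ x ∈ Fin _ ] toℕ x ≡ j)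
                 (c′ : Σ[ x ∈ Fin _ ] toℕ x ≡ c) (d′ : Σ[ x ∈ Fin _ ] toℕ x ≡ d) →
                 ¬ (j ≡ suc i × d ≡ suc c) → Crossing L (proj₁ i′) (proj₁ j′) (proj₁ c′) (proj₁ d′)
      crossing (_ , refl) (_ , refl) (_ , refl) (_ , refl) nondegenerate = i<j , c<d , e , f , nondegenerate

  LargeCleanLadder : ℕ → Set₁
  LargeCleanLadder r = Σ[ k ∈ ℕ ] Σ[ L ∈ Graph (Fin k) ] (r ≤ k × IsCleanLadder L × L ↪ G)

  path-↪ : ∀ {V : Set} {x y} (p : Path x y) {f : V → Fin n} (g : Fin (suc (len p)) → V) →
           (∀ i → f (g i) ≡ at p (toℕ i)) → path (suc (len p)) ↪ pullback G f
  path-↪ p {f} g fg = record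
    { map = g
    ; injective = λ {i} {j} eq → Fin.toℕ-injective (Path.at-injective p (bound i) (bound j)
        (trans (sym (fg i)) (trans (cong f eq) (fg j))))
    ; preserves = λ { {i} {j} (fwd eq) → subst₂ _~_ (sym (fg i)) (sym (fg j)) (consecutive i j eq)
                    ; {i} {j} (bwd eq) → ~-sym (subst₂ _~_ (sym (fg j)) (sym (fg i)) (consecutive j i eq)) }
    ; reflects = λ {i} {j} e → reflect i j (subst₂ _~_ (fg i) (fg j) e)
    }
    where
    bound : ∀ i → toℕ i ≤ len p
    bound i = s≤s⁻¹ (Fin.toℕ<n i)
    consecutive : ∀ i j → toℕ j ≡ suc (toℕ i) → at p (toℕ i) ~ at p (toℕ j)
    consecutive i j eq = subst (λ k → at p (toℕ i) ~ at p k) (sym eq) (Path.edge p (subst (_≤ len p) eq (bound j)))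
    reflect : ∀ i j → at p (toℕ i) ~ at p (toℕ j) → SymClosure _ i j
    reflect i j e with <-cmp (toℕ i) (toℕ j)
    ... | tri< i<j _ _ = fwd (Path.chordless p i<j (bound j) e)
    ... | tri≈ _ eq _  = contradiction e (~-irrefl (cong (at p) eq))
    ... | tri> _ _ j<i = bwd (Path.chordless p j<i (bound i) (~-sym e))

  -- The ladder is induced on the vertices of both paths: the first `suc lp` indices form the rail
  -- `X`, the others the rail `Y`.
  ladder : ∀ {a a′ b b′ r} (L : Link a a′ b b′) → Clean L → a ~ a′ → b ~ b′ →
           2 < r → r ≤ suc (len (p L)) + suc (len (q L)) → LargeCleanLadder r
  ladder {a} {a′} {b} {b′} {r} L L-clean σ τ 2<r r≤ =
    suc lp + suc lq , pullback G f , r≤ , (messy , degenerate) , pullback-↪ G f-injective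
    where
    lp = len (p L)
    lq = len (q L)
    fp : Fin (suc lp) → Fin n
    fp i = at (p L) (toℕ i)
    fq : Fin (suc lq) → Fin n
    fq i = at (q L) (toℕ i)
    f : Fin (suc lp + suc lq) → Fin n
    f i = [ fp , fq ]′ (splitAt (suc lp) i)
    x : Fin (suc lp) → Fin (suc lp + suc lq)
    x i = i ↑ˡ suc lq
    y : Fin (suc lq) → Fin (suc lp + suc lq)
    y j = suc lp ↑ʳ j
    f-x : ∀ i → f (x i) ≡ fp i
    f-x i = cong [ fp , fq ]′ (Fin.splitAt-↑ˡ (suc lp) i (suc lq))
    f-y : ∀ j → f (y j) ≡ fq j
    f-y j = cong [ fp , fq ]′ (Fin.splitAt-↑ʳ (suc lp) (suc lq) j)
    fin≤ : ∀ {k} (i : Fin (suc k)) → toℕ i ≤ k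
    fin≤ i = s≤s⁻¹ (Fin.toℕ<n i)
    fp≢fq : ∀ i j → fp i ≢ fq j
    fp≢fq i j = disjoint L (fin≤ i) (fin≤ j)
    cover : ∀ v → (∃ λ i → x i ≡ v) ⊎ (∃ λ j → y j ≡ v)
    cover v with splitAt (suc lp) v | Fin.join-splitAt (suc lp) (suc lq) v
    ... | inj₁ i | eq = inj₁ (i , eq)
    ... | inj₂ j | eq = inj₂ (j , eq)
    f-injective : ∀ {u v} → f u ≡ f v → u ≡ v
    f-injective {u} {v} eq with cover u | cover v
    ... | inj₁ (i , refl) | inj₁ (j , refl) =
      cong x (Fin.toℕ-injective (Path.at-injective (p L) (fin≤ i) (fin≤ j) (trans (sym (f-x i)) (trans eq (f-x j)))))
    ... | inj₁ (i , refl) | inj₂ (j , refl) = contradiction (trans (sym (f-x i)) (trans eq (f-y j))) (fp≢fq i j)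
    ... | inj₂ (i , refl) | inj₁ (j , refl) = contradiction (trans (sym (f-x j)) (trans (sym eq) (f-y i))) (fp≢fq j i)
    ... | inj₂ (i , refl) | inj₂ (j , refl) =
      cong y (Fin.toℕ-injective (Path.at-injective (q L) (fin≤ i) (fin≤ j) (trans (sym (f-y i)) (trans eq (f-y j)))))
    at-end : ∀ {u v} (p : Path u v) → at p (toℕ (fromℕ (len p))) ≡ v
    at-end p = trans (cong (at p) (Fin.toℕ-fromℕ (len p))) (Path.target p)
    messy : MessyLadder (pullback G f)
    messy = record
      { X = path-↪ (p L) x f-x
      ; Y = path-↪ (q L) y f-y
      ; disjoint = λ i j eq → fp≢fq i j (trans (sym (f-x i)) (trans (cong f eq) (f-y j)))
      ; covering = cover
      ; σ = subst₂ _~_ (sym (trans (f-x zero) (Path.source (p L)))) (sym (trans (f-y zero) (Path.source (q L)))) σ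
      ; τ = subst₂ _~_ (sym (trans (f-x (fromℕ lp)) (at-end (p L)))) (sym (trans (f-y (fromℕ lq)) (at-end (q L)))) τ
      -- Two trivial rails would give order 2, which is less than `r`.
      ; not-trivial = λ { (p≡0 , q≡0) → <⇒≱ 2<r (subst₂ (λ s t → r ≤ suc s + suc t) p≡0 q≡0 r≤) }
      }
    open MessyLadder messy using (Rung; Cross; Degenerate; endX; endY)
    rung-edge : (e : Rung) → fp (endX e) ~ fq (endY e)
    rung-edge e = subst₂ _~_ (f-x (endX e)) (f-y (endY e)) (Rung.edge e)
    degenerate : (e g : Rung) → Cross e g → Degenerate e g
    degenerate e g (eX<gX , gY<eY) =
      let gX≡ , eY≡ = L-clean eX<gX (fin≤ (endX g)) gY<eY (fin≤ (endY e)) (rung-edge e) (rung-edge g)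
      in single-edge (MessyLadder.X messy) gX≡ , single-edge (MessyLadder.Y messy) eY≡

-- Disjoint paths in 2-connected graphs

module Whitney {n} (G : Graph (Fin n)) (2-connected : IsConnected[ 2 ] G) where
  open Graph G
  open Paths G
  open Ladders G
  open Link

  walk-avoiding : ∀ {u v} w → u ≢ w → v ≢ w → ∃ (Walk (_≢ w) u v)
  walk-avoiding w u≢w v≢w = toWalk (proj₂ 2-connected ⁅ w ⁆ (s≤s (≤-reflexive (∣⁅x⁆∣≡1 w)))
      (_ , x∉p⇒x∈∁p (u≢w ∘ x∈⁅y⁆⇒x≡y w)) (_ , x∉p⇒x∈∁p (v≢w ∘ x∈⁅y⁆⇒x≡y w)))
    where
    ≢w : ∀ {x} → x ∈ ∁ ⁅ w ⁆ → x ≢ w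
    ≢w x∈ refl = x∈∁p⇒x∉p x∈ (x∈⁅x⁆ w)
    toWalk : ∀ {x y} → Star (Graph._~_ (induced G (∁ ⁅ w ⁆))) x y → ∃ (Walk (_≢ w) (proj₁ x) (proj₁ y))
    toWalk {_ , x∈} ε         = 0 , [ ≢w x∈ ]
    toWalk {_ , x∈} (e ◅ es) = let k , w′ = toWalk es in suc k , step (≢w x∈) e w′

  walk-start : ∀ {P x y k} → Walk P x y k → P x
  walk-start [ px ]        = px
  walk-start (step px _ _) = px

  -- After its last vertex in `Q` the walk never returns to `Q`, so this remainder can be glued to a
  -- path inside `Q` without further intersections.
  lastHit : ∀ {P Q : Fin n → Set} → U.Decidable Q → ∀ {x y k} → Walk P x y k →
    ∃ (Walk (λ v → ¬ Q v) x y) ⊎ (∃ λ z → Q z × P z × ∃ (Walk (λ v → v ≡ z ⊎ ¬ Q v) z y))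
  lastHit Q? {x} [ px ] with Q? x
  ... | yes qx = inj₂ (x , qx , px , 0 , [ inj₁ refl ])
  ... | no ¬qx = inj₁ (0 , [ ¬qx ])
  lastHit Q? {x} (step px e w) with lastHit Q? w | Q? x
  ... | inj₂ hit      | _      = inj₂ hit
  ... | inj₁ (k , w′) | yes qx = inj₂ (x , qx , px , suc k , step (inj₁ refl) e (mapWalk inj₂ w′))
  ... | inj₁ (k , w′) | no ¬qx = inj₁ (suc k , step ¬qx e w′)

  on? : ∀ {x y} (p : Path x y) → U.Decidable (Path.On p)
  on? p v = map′ (λ { (i , s≤s i≤ , eq) → i , i≤ , eq }) (λ { (i , i≤ , eq) → i , s≤s i≤ , eq })
                 (anyUpTo? (λ i → at p i Fin.≟ v) (suc (len p)))

  source≢target : ∀ {a a′ w w′} → Link a a′ w w′ → a′ ≢ w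
  source≢target L eq = disjoint L ≤-refl z≤n
    (trans (Path.target (p L)) (trans (sym eq) (sym (Path.source (q L)))))

  -- A walk to v avoiding w, from its last vertex on the link onwards, replaces the end of the
  -- path that it leaves; if that path ended in w, the other path is prolonged to w.
  extend : ∀ {a a′ w w′ v} → Link a a′ w w′ → w ~ w′ → w ~ v → Link a a′ v w ⊎ Link a′ a v w
  extend {a} {a′} {w} {w′} {v} L w~w′ w~v
    with _ , R ← walk-avoiding {a′} {v} w (source≢target L) (λ eq → ~-irrefl (sym eq) w~v)
    with lastHit (λ x → on? (p L) x ⊎-dec on? (q L) x) R
  ... | inj₁ (_ , R′) = ⊥-elim (walk-start R′ (inj₂ (Path.source-on (q L))))
  ... | inj₂ (z , inj₂ (i , i≤ , refl) , _ , _ , R′) =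
    inj₂ (proj₁ (link (mapWalk inj₁ (Path.toWalk q₁) ++ mapWalk from-z R′) (Path.toWalk (p L)) apart))
    where
    q₁ = Path.prefix (q L) i i≤
    Off = λ x → ¬ (Path.On (p L) x ⊎ Path.On (q L) x)
    from-z : ∀ {x} → x ≡ z ⊎ Off x → Path.On q₁ x ⊎ Off x
    from-z = Sum.map₁ λ { refl → Path.target-on q₁ }
    apart : ∀ {x} → Path.On q₁ x ⊎ Off x → ¬ Path.On (p L) x
    apart (inj₁ (s , s≤ , refl)) (t , t≤ , eq) = disjoint L t≤ (≤-trans s≤ i≤) eq
    apart (inj₂ off) on = off (inj₁ on)
  ... | inj₂ (z , inj₁ (i , i≤ , refl) , z≢w , _ , R′) =
    inj₁ (proj₁ (link (mapWalk inj₁ (Path.toWalk p₁) ++ mapWalk from-z R′)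
                      (mapWalk inj₁ (Path.toWalk (q L)) ++[ ~-sym w~w′ ]++ [ inj₂ refl ]) apart))
    where
    p₁ = Path.prefix (p L) i i≤
    i< : i < len (p L)
    i< = ≤∧≢⇒< i≤ λ { refl → z≢w (Path.target (p L)) }
    Off = λ x → ¬ (Path.On (p L) x ⊎ Path.On (q L) x)
    from-z : ∀ {x} → x ≡ z ⊎ Off x → Path.On p₁ x ⊎ Off x
    from-z = Sum.map₁ λ { refl → Path.target-on p₁ }
    apart : ∀ {x} → Path.On p₁ x ⊎ Off x → ¬ (Path.On (q L) x ⊎ x ≡ w)
    apart (inj₁ (s , s≤ , refl)) (inj₁ (t , t≤ , eq)) = disjoint L (≤-trans s≤ i≤) t≤ (sym eq)
    apart (inj₁ (s , s≤ , refl)) (inj₂ eq) =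
      Path.injective (p L) (≤-<-trans s≤ i<) ≤-refl (trans eq (sym (Path.target (p L))))
    apart (inj₂ off) (inj₁ on)   = off (inj₂ on)
    apart (inj₂ off) (inj₂ refl) = off (inj₁ (Path.target-on (p L)))

  -- The edge between `u` and `u′` and some edge at `v` are joined by two disjoint paths; which of
  -- `u` and `u′` is connected to `v` is left open.
  Linked : Fin n → Fin n → Fin n → Set
  Linked u u′ v = ∃ λ w → v ~ w × (Link u u′ v w ⊎ Link u′ u v w)

  -- The edge in which the two paths end moves along the walk: `extend` replaces it by the next edge
  -- of the walk.
  linked : ∀ {P u u′ v w k} → Linked u u′ v → Walk P v w k → Linked u u′ w
  linked L [ _ ] = L
  linked (_ , v~w , inj₁ L) (step _ e R) = linked (_ , ~-sym e , extend L v~w e) R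
  linked (_ , v~w , inj₂ L) (step _ e R) = linked (_ , ~-sym e , Sum.swap (extend L v~w e)) R

  module _ {r} (2<r : 2 < r) where

    ladder-or-short : ∀ {a a′ b b′} (L : Link a a′ b b′) → Clean L → a ~ a′ → b ~ b′ →
      LargeCleanLadder r ⊎ (len (p L) < r × len (q L) < r)
    ladder-or-short L L-clean σ τ with r ≤? suc (len (p L)) + suc (len (q L))
    ... | yes r≤ = inj₁ (ladder L L-clean σ τ 2<r r≤)
    ... | no  r≰ = inj₂ (m+n≤o⇒m≤o _ (<⇒≤ (≰⇒> r≰)) , m+n≤o⇒n≤o (suc (len (p L))) (<⇒≤ (≰⇒> r≰)))

    ShortPath : Fin n → Fin n → Set
    ShortPath u v = Σ[ p ∈ Path u v ] len p ≤ r

    prepend : ∀ {u u′ v} → u ~ u′ → (p : Path u′ v) → len p < r → ShortPath u v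
    prepend e p lt =
      let p′ , le , _ = induce (step tt e (mapWalk (λ _ → tt) (Path.toWalk p)))
      in p′ , ≤-trans le lt

    -- Cleaning may exchange the targets, so the rail that ends in `v` starts in `u` or in `u′`. In
    -- the latter case `u` is put in front of it, which is why the bound is `r` although the rails
    -- are shorter than `r`.
    ladder-or-path : ∀ {u u′ v} → u ~ u′ → Linked u u′ v → LargeCleanLadder r ⊎ ShortPath u v
    ladder-or-path {u} {u′} {v} σ (w , τ , inj₁ L) with clean _ L ≤-refl
    ... | inj₁ (M , M-clean) = Sum.map₂ (λ lt → p M , <⇒≤ (proj₁ lt)) (ladder-or-short M M-clean σ τ)
    ... | inj₂ (M , M-clean) = Sum.map₂ (λ lt → prepend σ (q M) (proj₂ lt)) (ladder-or-short M M-clean σ (~-sym τ))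
    ladder-or-path {u} {u′} {v} σ (w , τ , inj₂ L) with clean _ L ≤-refl
    ... | inj₁ (M , M-clean) = Sum.map₂ (λ lt → prepend σ (p M) (proj₁ lt)) (ladder-or-short M M-clean (~-sym σ) τ)
    ... | inj₂ (M , M-clean) = Sum.map₂ (λ lt → q M , <⇒≤ (proj₂ lt)) (ladder-or-short M M-clean (~-sym σ) (~-sym τ))

-- Subdivisions of K₂,ᵣ

-- An induced subdivision of K₂,ᵣ in which adjacency of the two hubs is left open. A leg has the
-- vertices `leg j 0` to `leg j (len j)`; with `len j` equal to 0 it is a single vertex adjacent to
-- both hubs.
record Theta {V : Set} (G : Graph V) (r : ℕ) : Set where
  open Graph G
  field
    hub₀ hub₁     : V
    leg           : Fin r → ℕ → V
    len           : Fin r → ℕ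
    hub₀≢hub₁     : hub₀ ≢ hub₁
    hub₀∉leg      : ∀ {j t} → t ≤ len j → hub₀ ≢ leg j t
    hub₁∉leg      : ∀ {j t} → t ≤ len j → hub₁ ≢ leg j t
    leg-injective : ∀ {j t t′} → t ≤ len j → t′ ≤ len j → leg j t ≡ leg j t′ → t ≡ t′
    leg-edge      : ∀ {j t} → t < len j → leg j t ~ leg j (suc t)
    leg-chordless : ∀ {j t t′} → t < t′ → t′ ≤ len j → leg j t ~ leg j t′ → t′ ≡ suc t
    disjoint      : ∀ {i j t t′} → i ≢ j → t ≤ len i → t′ ≤ len j → leg i t ≢ leg j t′
    nonadjacent   : ∀ {i j t t′} → i ≢ j → t ≤ len i → t′ ≤ len j → ¬ leg i t ~ leg j t′
    first-edge    : ∀ j → hub₀ ~ leg j 0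
    first-only    : ∀ {j t} → t ≤ len j → hub₀ ~ leg j t → t ≡ 0
    last-edge     : ∀ j → hub₁ ~ leg j (len j)
    last-only     : ∀ {j t} → t ≤ len j → hub₁ ~ leg j t → t ≡ len j

module ThetaSubdivision {V : Set} (G : Graph V) {r : ℕ} (T : Theta G r) where
  open Graph G
  open Theta T

  -- The last vertex of each leg serves as `mid j`, so all subdividing vertices lie between it and
  -- the first hub.
  subdivisions : Fin 2 → Fin r → ℕ
  subdivisions zero    j = len j
  subdivisions (suc _) _ = 0

  private
    S = SubV subdivisions
    E = SubE subdivisions

  -- The second hub has no subdividing vertices, so only these four shapes occur.
  data View : S → Set where
    left  : View (hub zero)
    right : View (hub (suc zero))
    mid   : ∀ j → View (mid j)
    inner : ∀ j (k : Fin (len j)) → View (new zero j k)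

  view : ∀ v → View v
  view (hub zero)         = left
  view (hub (suc zero))   = right
  view (mid j)            = mid j
  view (new zero j k)     = inner j k
  view (new (suc zero) _ ())

  place : S → V
  place (hub zero)       = hub₀
  place (hub (suc _))    = hub₁
  place (mid j)          = leg j (len j)
  place (new zero j k)   = leg j (toℕ k)
  place (new (suc _) _ ())

  leg-≡ : ∀ {i j t t′} → t ≤ len i → t′ ≤ len j → leg i t ≡ leg j t′ → i ≡ j × t ≡ t′
  leg-≡ {i} {j} t≤ t′≤ eq with i Fin.≟ j
  ... | yes refl = refl , leg-injective t≤ t′≤ eq
  ... | no  i≢j  = contradiction eq (disjoint i≢j t≤ t′≤)

  leg-~ : ∀ {i j t t′} → t ≤ len i → t′ ≤ len j → leg i t ~ leg j t′ → i ≡ j × (t′ ≡ suc t ⊎ t ≡ suc t′)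
  leg-~ {i} {j} {t} {t′} t≤ t′≤ e with i Fin.≟ j
  ... | no  i≢j  = contradiction e (nonadjacent i≢j t≤ t′≤)
  ... | yes refl with <-cmp t t′
  ...   | tri< lt _ _ = refl , inj₁ (leg-chordless lt t′≤ e)
  ...   | tri≈ _ eq _ = contradiction e (~-irrefl (cong (leg i) eq))
  ...   | tri> _ _ gt = refl , inj₂ (leg-chordless gt t≤ (~-sym e))

  toℕ≤ : ∀ {k} (i : Fin k) → toℕ i ≤ k
  toℕ≤ i = <⇒≤ (Fin.toℕ<n i)

  place-injective : ∀ {u v} → place u ≡ place v → u ≡ v
  place-injective {u} {v} = go (view u) (view v)
    where
    go : ∀ {u v} → View u → View v → place u ≡ place v → u ≡ v
    go left        left        _  = refl
    go left        right       eq = contradiction eq hub₀≢hub₁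
    go left        (mid j)     eq = contradiction eq (hub₀∉leg ≤-refl)
    go left        (inner j k) eq = contradiction eq (hub₀∉leg (toℕ≤ k))
    go right       left        eq = contradiction (sym eq) hub₀≢hub₁
    go right       right       _  = refl
    go right       (mid j)     eq = contradiction eq (hub₁∉leg ≤-refl)
    go right       (inner j k) eq = contradiction eq (hub₁∉leg (toℕ≤ k))
    go (mid i)     left        eq = contradiction (sym eq) (hub₀∉leg ≤-refl)
    go (mid i)     right       eq = contradiction (sym eq) (hub₁∉leg ≤-refl)
    go (mid i)     (mid j)     eq = cong mid (proj₁ (leg-≡ ≤-refl ≤-refl eq))
    go (mid i)     (inner j k) eq with leg-≡ ≤-refl (toℕ≤ k) eq
    ... | refl , len≡k = contradiction (sym len≡k) (<⇒≢ (Fin.toℕ<n k))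
    go (inner i k) left        eq = contradiction (sym eq) (hub₀∉leg (toℕ≤ k))
    go (inner i k) right       eq = contradiction (sym eq) (hub₁∉leg (toℕ≤ k))
    go (inner i k) (mid j)     eq with leg-≡ (toℕ≤ k) ≤-refl eq
    ... | refl , k≡len = contradiction k≡len (<⇒≢ (Fin.toℕ<n k))
    go (inner i k) (inner j l) eq with leg-≡ (toℕ≤ k) (toℕ≤ l) eq
    ... | refl , k≡l = cong (new zero i) (Fin.toℕ-injective k≡l)

  place-edge : ∀ {u v} → E u v → place u ~ place v
  place-edge (whole {zero} {j} len≡0)  = subst (λ t → hub₀ ~ leg j t) (sym len≡0) (first-edge j)
  place-edge (whole {suc zero} {j} _)  = last-edge j
  place-edge (first {zero} {j} k≡0)    = subst (λ t → hub₀ ~ leg j t) (sym k≡0) (first-edge j)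
  place-edge (first {suc zero} {k = ()} _)
  place-edge (inner {zero} {j} {k} {l} l≡1+k) =
    subst (λ t → leg j (toℕ k) ~ leg j t) (sym l≡1+k) (leg-edge (Fin.toℕ<n k))
  place-edge (inner {suc zero} {k = ()} _)
  place-edge (last {zero} {j} {k} 1+k≡len) =
    subst (λ t → leg j (toℕ k) ~ leg j t) 1+k≡len (leg-edge (Fin.toℕ<n k))
  place-edge (last {suc zero} {k = ()} _)

  place-SymClosure : ∀ {u v} → SymClosure E u v → place u ~ place v
  place-SymClosure (fwd e) = place-edge e
  place-SymClosure (bwd e) = ~-sym (place-edge e)

  HubPair : Rel S 0ℓ
  HubPair u v = u ≡ hub zero × v ≡ hub (suc zero)

  -- The pair of hubs is kept apart because its adjacency alone decides between the two families.
  place-reflects : ∀ {u v} → place u ~ place v → SymClosure E u v ⊎ SymClosure HubPair u v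
  place-reflects {u} {v} = go (view u) (view v)
    where
    hub₀-mid : ∀ j → hub₀ ~ leg j (len j) → E (hub zero) (mid j)
    hub₀-mid j e = whole (first-only ≤-refl e)
    hub₀-inner : ∀ j k → hub₀ ~ leg j (toℕ k) → E (hub zero) (new zero j k)
    hub₀-inner j k e = first (first-only (toℕ≤ k) e)
    hub₁-inner : ∀ j (k : Fin (len j)) → ¬ hub₁ ~ leg j (toℕ k)
    hub₁-inner j k e = <⇒≢ (Fin.toℕ<n k) (last-only (toℕ≤ k) e)
    inner-mid : ∀ {i j} (k : Fin (len i)) → leg i (toℕ k) ~ leg j (len j) → E (new zero i k) (mid j)
    inner-mid k e with leg-~ (toℕ≤ k) ≤-refl e
    ... | refl , inj₁ len≡1+k = last (sym len≡1+k)
    ... | refl , inj₂ k≡1+len = contradiction (Fin.toℕ<n k) (<⇒≱ (s≤s (subst (_ ≤_) (sym k≡1+len) (n≤1+n _))))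
    go : ∀ {u v} → View u → View v → place u ~ place v → SymClosure E u v ⊎ SymClosure HubPair u v
    go left        left        e = contradiction e (~-irrefl refl)
    go left        right       e = inj₂ (fwd (refl , refl))
    go left        (mid j)     e = inj₁ (fwd (hub₀-mid j e))
    go left        (inner j k) e = inj₁ (fwd (hub₀-inner j k e))
    go right       left        e = inj₂ (bwd (refl , refl))
    go right       right       e = contradiction e (~-irrefl refl)
    go right       (mid j)     e = inj₁ (fwd (whole refl))
    go right       (inner j k) e = contradiction e (hub₁-inner j k)
    go (mid i)     left        e = inj₁ (bwd (hub₀-mid i (~-sym e)))
    go (mid i)     right       e = inj₁ (bwd (whole refl))
    go (mid i)     (mid j)     e with leg-~ ≤-refl ≤-refl e
    ... | refl , _ = contradiction e (~-irrefl refl)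
    go (mid i)     (inner j k) e = inj₁ (bwd (inner-mid k (~-sym e)))
    go (inner i k) left        e = inj₁ (bwd (hub₀-inner i k (~-sym e)))
    go (inner i k) right       e = contradiction (~-sym e) (hub₁-inner i k)
    go (inner i k) (mid j)     e = inj₁ (fwd (inner-mid k e))
    go (inner i k) (inner j l) e with leg-~ (toℕ≤ k) (toℕ≤ l) e
    ... | refl , inj₁ l≡1+k = inj₁ (fwd (inner l≡1+k))
    ... | refl , inj₂ k≡1+l = inj₁ (bwd (inner k≡1+l))

  theta-↪ : subdividedK₂ subdivisions ↪ G ⊎ subdividedK₂⁺ subdivisions ↪ G
  theta-↪ with hub₀ ~? hub₁
  ... | yes hubs~ = inj₂ record
    { map = place ; injective = place-injective
    ; preserves = λ { (fwd (inj₁ e)) → place-SymClosure e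
                    ; (fwd (inj₂ (refl , refl))) → hubs~
                    ; (bwd (inj₁ e)) → ~-sym (place-SymClosure e)
                    ; (bwd (inj₂ (refl , refl))) → ~-sym hubs~ }
    ; reflects = λ e → reflect (place-reflects e) }
    where
    reflect : ∀ {u v} → SymClosure E u v ⊎ SymClosure HubPair u v → Graph._~_ (subdividedK₂⁺ subdivisions) u v
    reflect (inj₁ e)       = fwd (inj₁ e)
    reflect (inj₂ (fwd h)) = fwd (inj₂ h)
    reflect (inj₂ (bwd h)) = bwd (inj₂ h)
  ... | no hubs≁ = inj₁ record
    { map = place ; injective = place-injective ; preserves = place-SymClosure
    ; reflects = λ e → reflect e (place-reflects e) }
    where
    reflect : ∀ {u v} → place u ~ place v → SymClosure E u v ⊎ SymClosure HubPair u v → SymClosure E u v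
    reflect _ (inj₁ e)                    = e
    reflect e (inj₂ (fwd (refl , refl))) = contradiction e hubs≁
    reflect e (inj₂ (bwd (refl , refl))) = contradiction (~-sym e) hubs≁

-- Spiders

private variable ℓ : Level

sequence : ∀ {A : Set ℓ} {B : Set} {X : B → Set} {xs} → All (λ x → A ⊎ X x) xs → A ⊎ All X xs
sequence []              = inj₂ []
sequence (inj₁ a ∷ _)    = inj₁ a
sequence (inj₂ x ∷ rest) = Sum.map₂ (x ∷_) (sequence rest)

module _ {A B : Set} {P : A → Set} (f : ∀ {x} → P x → B) where

  length-reduce : ∀ {xs} (ps : All P xs) → length (All.reduce f ps) ≡ length xs
  length-reduce []       = refl
  length-reduce (_ ∷ ps) = cong suc (length-reduce ps)

  All-reduce⁺ : ∀ {Q : B → Set} {xs} → All (λ x → (p : P x) → Q (f p)) xs → (ps : All P xs) → All Q (All.reduce f ps)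
  All-reduce⁺ []       []       = []
  All-reduce⁺ (q ∷ qs) (p ∷ ps) = q p ∷ All-reduce⁺ qs ps

  AllPairs-reduce⁺ : ∀ {R : Rel B 0ℓ} {xs} → AllPairs (λ x y → (p : P x) (q : P y) → R (f p) (f q)) xs →
                     (ps : All P xs) → AllPairs R (All.reduce f ps)
  AllPairs-reduce⁺ []       []       = []
  AllPairs-reduce⁺ (r ∷ rs) (p ∷ ps) = All-reduce⁺ (All.map (λ r′ → r′ p) r) ps ∷ AllPairs-reduce⁺ rs ps

module _ {A I : Set} where

  All-∀ : ∀ {P : I → A → Set} {xs} → (∀ i → All (P i) xs) → All (λ x → ∀ i → P i x) xs
  All-∀ {xs = []}     _  = []
  All-∀ {xs = x ∷ xs} ps = (λ i → All.head (ps i)) ∷ All-∀ (λ i → All.tail (ps i))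

  AllPairs-∀ : ∀ {R : I → Rel A 0ℓ} {xs} → (∀ i → AllPairs (R i) xs) → AllPairs (λ x y → ∀ i → R i x y) xs
  AllPairs-∀ {xs = []}     _  = []
  AllPairs-∀ {xs = x ∷ xs} rs = All-∀ (λ i → AllPairs.head (rs i)) ∷ AllPairs-∀ (λ i → AllPairs.tail (rs i))

  some-total-or-all-empty : ∀ {R : I → Rel A 0ℓ} {xs is} → All (λ i → Homogeneous (R i) xs) is →
    (∃ λ i → Total (R i) xs) ⊎ All (λ i → Empty (R i) xs) is
  some-total-or-all-empty []             = inj₂ []
  some-total-or-all-empty (inj₁ t ∷ _)   = inj₁ (_ , t)
  some-total-or-all-empty (inj₂ e ∷ hs)  = Sum.map₂ (e ∷_) (some-total-or-all-empty hs)

findFirst : {P : ℕ → Set} → U.Decidable P → ∀ n → P n → ∃ λ i → i ≤ n × P i × (∀ {j} → j < i → ¬ P j)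
findFirst P? n p with P? 0
... | yes p₀ = 0 , z≤n , p₀ , λ ()
findFirst P? zero p | no ¬p₀ = contradiction p ¬p₀
findFirst {P} P? (suc n) p | no ¬p₀ with findFirst (P? ∘ suc) n p
... | i , i≤ , pi , earlier = suc i , s≤s i≤ , pi , earlier′
  where
  earlier′ : ∀ {j} → j < suc i → ¬ P j
  earlier′ {zero}  _        = ¬p₀
  earlier′ {suc j} (s≤s lt) = earlier lt

pairwise : ∀ {A : Set} {R : Rel A 0ℓ} {m} {f : Fin m → A} → Symmetric R →
  (∀ {i j} → i Fin.< j → R (f i) (f j)) → ∀ {i j} → i ≢ j → R (f i) (f j)
pairwise R-sym rf {i} {j} i≢j with Fin.<-cmp i j
... | tri< i<j _ _ = rf i<j
... | tri≈ _ i≡j _ = contradiction i≡j i≢j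
... | tri> _ _ j<i = R-sym (rf j<i)

Unavoidable : ∀ {n} → ℕ → Graph (Fin n) → Set₁
Unavoidable r G =
  (complete r ↪ G)
  ⊎ (Σ[ k ∈ ℕ ] Σ[ L ∈ Graph (Fin k) ] (r ≤ k × IsCleanLadder L × L ↪ G))
  ⊎ (Σ[ s ∈ (Fin 2 → Fin r → ℕ) ] (subdividedK₂ s ↪ G))
  ⊎ (Σ[ s ∈ (Fin 2 → Fin r → ℕ) ] (subdividedK₂⁺ s ↪ G))

theta-unavoidable : ∀ {n r} {G : Graph (Fin n)} → Theta G r → Unavoidable r G
theta-unavoidable {G = G} T with ThetaSubdivision.theta-↪ G T
... | inj₁ e = inj₂ (inj₂ (inj₁ (_ , e)))
... | inj₂ e = inj₂ (inj₂ (inj₂ (_ , e)))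

clique-↪ : ∀ {V : Set} {r} (G : Graph V) {f : Fin r → V} →
  (∀ {i j} → i ≢ j → Graph._~_ G (f i) (f j)) → complete r ↪ G
clique-↪ G {f} adj = record
  { map = f
  ; injective = λ {i} {j} eq → inj i j eq
  ; preserves = adj
  ; reflects = λ { e refl → Graph.~-irrefl G refl e } }
  where
  inj : ∀ i j → f i ≡ f j → i ≡ j
  inj i j eq with i Fin.≟ j
  ... | yes i≡j = i≡j
  ... | no  i≢j = contradiction (adj i≢j) (Graph.~-irrefl G eq)

-- Positions on a leg are counted from its root exclusively: position a is the vertex numbered a + 1.
-- Homogeneity for stub bounds the number of legs that consist of the root alone.
data Pattern : Set where
  stub      : Pattern
  meet join : ℕ → ℕ → Pattern

positions : ℕ → List (ℕ × ℕ)
positions r = cartesianProduct (upTo r) (upTo r)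

meets joins patterns : ℕ → List Pattern
meets r    = map (uncurry meet) (positions r)
joins r    = map (uncurry join) (positions r)
patterns r = stub ∷ meets r ++ₗ joins r

-- The second argument bounds the lengths of the legs. At bound 0 two legs already contradict
-- distinctness of ends. Otherwise the homogeneous list must serve every outcome: `3 + r` legs for a
-- clique or a K₂,ᵣ, `3 + m` for a spider, and one more than the next size after cutting.
spiderSize : ℕ → ℕ → ℕ → ℕ
spiderSize r zero    m = 2
spiderSize r (suc k) m = homogeneousSize (length (patterns r)) (3 + (r + m + spiderSize r k m))

-- In the search for a vertex of large degree `P` and `Q` are always true. Later `P` keeps the legs
-- off a vertex `w`, and `Q` makes them end in neighbours of `w`.
module Spiders {n} (G : Graph (Fin n)) (r : ℕ) (P Q : Fin n → Set) where
  open Graph G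
  open Paths G

  record Leg (x : Fin n) : Set where
    field
      end    : Fin n
      route  : Path x end
      inside : Inside P route
      hits   : Q end
      short  : len route ≤ r
    open Path route public hiding (len; at)

    length′ : ℕ
    length′ = len route

    at′ : ℕ → Fin n
    at′ = at route

  open Leg using (end; length′; at′)

  ⟦_⟧ : Pattern → ∀ {x} → Rel (Leg x) 0ℓ
  ⟦ stub ⟧  p q = length′ q ≡ 0
  ⟦ meet a b ⟧ p q = suc a ≤ length′ p × suc b ≤ length′ q × at′ p (suc a) ≡ at′ q (suc b)
  ⟦ join a b ⟧ p q = suc a ≤ length′ p × suc b ≤ length′ q × at′ p (suc a) ~ at′ q (suc b)

  ⟦_⟧? : ∀ π {x} → Decidable (⟦ π ⟧ {x})
  ⟦ stub ⟧?  p q = length′ q ≟ 0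
  ⟦ meet a b ⟧? p q = (suc a ≤? length′ p) ×-dec (suc b ≤? length′ q) ×-dec (_ Fin.≟ _)
  ⟦ join a b ⟧? p q = (suc a ≤? length′ p) ×-dec (suc b ≤? length′ q) ×-dec (_ ~? _)

  Apart : ∀ {x} → Rel (Leg x) 0ℓ
  Apart p q = ∀ {a b} → a < length′ p → b < length′ q →
    at′ p (suc a) ≢ at′ q (suc b) × ¬ at′ p (suc a) ~ at′ q (suc b)

  Apart-sym : ∀ {x} → Symmetric (Apart {x})
  Apart-sym apart a< b< = let ≢ , ≁ = apart b< a< in ≢ ∘ sym , ≁ ∘ ~-sym

  Distinct : ∀ {x} → List (Leg x) → Set
  Distinct = AllPairs (λ p q → end p ≢ end q)

  stub-end : ∀ {x} (p : Leg x) → length′ p ≡ 0 → end p ≡ x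
  stub-end p eq = trans (sym (Leg.target p)) (trans (cong (at′ p) eq) (Leg.source p))

  stub-ends : ∀ {x} (p q : Leg x) → length′ p ≡ 0 → length′ q ≡ 0 → end p ≡ end q
  stub-ends p q p≡0 q≡0 = trans (stub-end p p≡0) (sym (stub-end q q≡0))

  -- The new root is named as a vertex of `p`, so that the remainders of all legs meeting `p` there
  -- share one root.
  cut : ∀ {x} (p : Leg x) a b (q : Leg x) → ⟦ meet a b ⟧ p q → Leg (at′ p (suc a))
  cut p a b q (_ , b< , eq) = subst Leg (sym eq) record
    { end = end q ; route = Leg.suffix q (suc b) b<
    ; inside = suffix-inside {P = P} (Leg.route q) b< (Leg.inside q)
    ; hits = Leg.hits q
    ; short = ≤-trans (m∸n≤m _ (suc b)) (Leg.short q) }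

  subst-end : ∀ {x y} (eq : x ≡ y) (p : Leg x) → end (subst Leg eq p) ≡ end p
  subst-end refl p = refl

  subst-length : ∀ {x y} (eq : x ≡ y) (p : Leg x) → length′ (subst Leg eq p) ≡ length′ p
  subst-length refl p = refl

  Spider : ℕ → Set
  Spider m = ∃ λ x → Σ[ ps ∈ List (Leg x) ] m ≤ length ps × All (λ p → length′ p ≢ 0) ps × AllPairs Apart ps

  clique : ∀ {x a} (ps : List (Leg x)) → r ≤ length ps → Total ⟦ join a a ⟧ ps → complete r ↪ G
  clique {a = a} ps r≤ total =
    let f , _ , adj = select {P = λ _ → ⊤} r≤ (All.universal (λ _ → tt) ps) total
    in clique-↪ G {λ i → at′ (f i) (suc a)}
         (pairwise {R = λ p q → at′ p (suc a) ~ at′ q (suc a)} {f = f} ~-sym (λ i<j → proj₂ (proj₂ (adj i<j))))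

  -- The hubs are the vertices of `p` and `q` at position `a`; each other leg contributes its vertex
  -- at position `b` as a one-vertex leg of the theta.
  K₂ᵣ : ∀ {x a b} (p q : Leg x) (ps : List (Leg x)) → r ≤ length ps → at′ p (suc a) ≢ at′ q (suc a) →
    All (⟦ join a b ⟧ p) ps → All (⟦ join a b ⟧ q) ps → Empty ⟦ meet b b ⟧ ps → Empty ⟦ join b b ⟧ ps → Theta G r
  K₂ᵣ {a = a} {b} p q ps r≤ p≢q p~ q~ disjoint nonadjacent = record
    { hub₀ = at′ p (suc a) ; hub₁ = at′ q (suc a)
    ; leg = λ j _ → v j ; len = λ _ → 0
    ; hub₀≢hub₁ = p≢q
    ; hub₀∉leg = λ {j} _ eq → ~-irrefl eq (hub₀~ j)
    ; hub₁∉leg = λ {j} _ eq → ~-irrefl eq (hub₁~ j)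
    ; leg-injective = λ { z≤n z≤n _ → refl }
    ; leg-edge = λ ()
    ; leg-chordless = λ { (s≤s _) () }
    ; disjoint = λ i≢j _ _ → proj₁ (apart i≢j)
    ; nonadjacent = λ i≢j _ _ → proj₂ (apart i≢j)
    ; first-edge = hub₀~ ; first-only = λ { z≤n _ → refl }
    ; last-edge = hub₁~ ; last-only = λ { z≤n _ → refl } }
    where
    selected = select {R = λ s t → ¬ ⟦ meet b b ⟧ s t × ¬ ⟦ join b b ⟧ s t} r≤
      (All.zip (p~ , q~)) (AllPairs.zip (disjoint , nonadjacent))
    f = proj₁ selected
    v : Fin r → Fin n
    v j = at′ (f j) (suc b)
    b< : ∀ j → b < length′ (f j)
    b< j = proj₁ (proj₂ (proj₁ (proj₁ (proj₂ selected) j)))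
    hub₀~ : ∀ j → at′ p (suc a) ~ v j
    hub₀~ j = proj₂ (proj₂ (proj₁ (proj₁ (proj₂ selected) j)))
    hub₁~ : ∀ j → at′ q (suc a) ~ v j
    hub₁~ j = proj₂ (proj₂ (proj₂ (proj₁ (proj₂ selected) j)))
    apart : ∀ {i j} → i ≢ j → v i ≢ v j × ¬ v i ~ v j
    apart = pairwise {R = λ s t → s ≢ t × ¬ s ~ t} {f = v} (λ { (≢ , ≁) → ≢ ∘ sym , ≁ ∘ ~-sym })
      (λ {i} {j} i<j → let ¬meet , ¬join = proj₂ (proj₂ selected) i<j in
        (λ eq → ¬meet (b< i , b< j , eq)) , (λ e → ¬join (b< i , b< j , e)))

  Index : Set
  Index = Σ[ (a , b) ∈ ℕ × ℕ ] a < r × b < r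

  lookup-position : ∀ {S : ℕ × ℕ → Set} → All S (positions r) → ∀ (i : Index) → S (proj₁ i)
  lookup-position all (_ , a< , b<) = All.lookup all (∈-cartesianProduct⁺ (∈-upTo⁺ a<) (∈-upTo⁺ b<))

  -- If neither row is a clique, the first two legs give the hubs and the later ones the common
  -- neighbours, since `join a b` is oriented by the order of the list. The third leg `s` also
  -- certifies that `q` reaches position `a`.
  from-join : ∀ {x a b} (ps : List (Leg x)) → 3 + r ≤ length ps → Total ⟦ join a b ⟧ ps →
    (∀ (((c , d) , _) : Index) → Empty ⟦ meet c d ⟧ ps) → (∀ (((c , d) , _) : Index) → Homogeneous ⟦ join c d ⟧ ps) → Unavoidable r G
  from-join (_ ∷ [])     (s≤s ())
  from-join (_ ∷ _ ∷ []) (s≤s (s≤s ()))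
  from-join {a = a} {b} (p ∷ q ∷ s ∷ ps) large (((a< , b< , _) ∷ p~) ∷ q~@((a<′ , _) ∷ _) ∷ _) no-meets joins-hom
    with <-≤-trans a< (Leg.short p) | <-≤-trans b< (Leg.short q)
  ... | a<r | b<r with joins-hom ((a , a) , a<r , a<r) | joins-hom ((b , b) , b<r , b<r)
  ...   | inj₁ total | _          = inj₁ (clique _ (m+n≤o⇒n≤o 3 large) total)
  ...   | inj₂ _     | inj₁ total = inj₁ (clique _ (m+n≤o⇒n≤o 3 large) total)
  ...   | inj₂ _     | inj₂ (_ ∷ _ ∷ none) with no-meets ((a , a) , a<r , a<r) | no-meets ((b , b) , b<r , b<r)
  ...     | ((p≢q ∷ _) ∷ _) | (_ ∷ _ ∷ disjoint) =
    theta-unavoidable (K₂ᵣ p q (s ∷ ps) (≤-trans (n≤1+n r) (s≤s⁻¹ (s≤s⁻¹ large))) (λ eq → p≢q (a< , a<′ , eq)) p~ q~ disjoint none)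

  -- `stub` tests the later leg of a pair, so it says nothing about the first leg, which is dropped.
  -- If it held throughout, the second and third legs would both end in the root.
  from-apart : ∀ {m x} (ps : List (Leg x)) → 3 + m ≤ length ps → Distinct ps → Homogeneous ⟦ stub ⟧ ps →
    (∀ (((c , d) , _) : Index) → Empty ⟦ meet c d ⟧ ps) → (∀ (((c , d) , _) : Index) → Empty ⟦ join c d ⟧ ps) → Spider m
  from-apart (_ ∷ [])     (s≤s ())
  from-apart (_ ∷ _ ∷ []) (s≤s (s≤s ()))
  from-apart (_ ∷ p ∷ q ∷ _) _ (_ ∷ (p≢q ∷ _) ∷ _) (inj₁ ((p≡0 ∷ q≡0 ∷ _) ∷ _)) _ _ =
    contradiction (stub-ends p q p≡0 q≡0) p≢q
  from-apart (_ ∷ ps) (s≤s large) _ (inj₂ (nontrivial ∷ _)) no-meets no-joins =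
    _ , ps , ≤-trans (≤-trans (n≤1+n _) (n≤1+n _)) large , nontrivial ,
    AllPairs.map (λ {p} {q} → apart p q) (AllPairs.tail (AllPairs.zip (AllPairs-∀ no-meets , AllPairs-∀ no-joins)))
    where
    apart : ∀ p q → (∀ (((c , d) , _) : Index) → ¬ ⟦ meet c d ⟧ p q) × (∀ (((c , d) , _) : Index) → ¬ ⟦ join c d ⟧ p q) → Apart p q
    apart p q (no-meet , no-join) {a} {b} a< b< =
      (λ eq → no-meet i (a< , b< , eq)) , (λ e → no-join i (a< , b< , e))
      where
      i : Index
      i = (a , b) , <-≤-trans a< (Leg.short p) , <-≤-trans b< (Leg.short q)

  Family : ℕ → ℕ → Set
  Family k m = ∃ λ x → Σ[ ps ∈ List (Leg x) ] All (λ p → length′ p ≤ k) ps × Distinct ps × m ≤ length ps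

  -- All legs after the first pass through its vertex at position `a`. Cut there, each loses `suc b`
  -- edges, so at least one, and keeps its end.
  from-meet : ∀ {k m x a b} (ps : List (Leg x)) → All (λ p → length′ p ≤ suc k) ps → Distinct ps →
    suc m ≤ length ps → Total ⟦ meet a b ⟧ ps → Family k m
  from-meet {k} {m} {a = a} {b} (p ∷ ps) (_ ∷ ps≤) (_ ∷ distinct) (s≤s m≤) (meets-p ∷ _) =
    _ , All.reduce (λ {q} → cut p a b q) meets-p ,
    All-reduce⁺ (λ {q} → cut p a b q) (All.map (λ {q} → cut-short q) ps≤) meets-p ,
    AllPairs-reduce⁺ (λ {q} → cut p a b q) (AllPairs.map (λ {q} {q′} → cut-distinct q q′) distinct) meets-p ,
    subst (m ≤_) (sym (length-reduce (λ {q} → cut p a b q) meets-p)) m≤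
    where
    cut-short : ∀ q → length′ q ≤ suc k → (mt : ⟦ meet a b ⟧ p q) → length′ (cut p a b q mt) ≤ k
    cut-short q q≤ (_ , b< , eq) = subst (_≤ k) (sym (subst-length (sym eq) _))
      (≤-trans (∸-monoˡ-≤ (suc b) q≤) (m∸n≤m k b))
    cut-distinct : ∀ q q′ → end q ≢ end q′ → (mt : ⟦ meet a b ⟧ p q) (mt′ : ⟦ meet a b ⟧ p q′) →
      end (cut p a b q mt) ≢ end (cut p a b q′ mt′)
    cut-distinct q q′ q≢q′ (_ , _ , e) (_ , _ , e′) eq =
      q≢q′ (trans (sym (subst-end (sym e) _)) (trans eq (subst-end (sym e′) _)))

  spider-step : ∀ {k m l x} (ps : List (Leg x)) → All (λ p → length′ p ≤ suc k) ps → Distinct ps →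
    homogeneousSize (length (patterns r)) (3 + (r + m + l)) ≤ length ps →
    Unavoidable r G ⊎ Spider m ⊎ Family k l
  spider-step {k} {m} {l} ps ps≤ distinct size≤
    with homogenise (λ π → ⟦ π ⟧?) (3 + (r + m + l)) (patterns r) ps size≤
  ... | qs , τ , large , stub-hom ∷ homs
    with some-total-or-all-empty (All.map⁻ (All.++⁻ˡ (meets r) homs))
       | some-total-or-all-empty (All.map⁻ (All.++⁻ʳ (meets r) homs))
  ...   | inj₁ (_ , total) | _ = inj₂ (inj₂ (from-meet qs (All-resp-⊆ τ ps≤) (AllPairs-resp-⊆ τ distinct)
            (≤-trans (s≤s (m≤n+m l (2 + (r + m)))) large) total))
  ...   | inj₂ no-meets | inj₁ (_ , total) = inj₁ (from-join qs
            (≤-trans (+-monoʳ-≤ 3 (≤-trans (m≤m+n r m) (m≤m+n (r + m) l))) large) total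
            (lookup-position no-meets) (lookup-position (All.map⁻ (All.++⁻ʳ (meets r) homs))))
  ...   | inj₂ no-meets | inj₂ no-joins = inj₂ (inj₁ (from-apart qs
            (≤-trans (+-monoʳ-≤ 3 (≤-trans (m≤n+m m r) (m≤m+n (r + m) l))) large)
            (AllPairs-resp-⊆ τ distinct) stub-hom
            (lookup-position no-meets) (lookup-position no-joins)))

  -- Induction on `k`: each restart from a common vertex shortens the legs, while the bound `r` in
  -- `short`, and with it the list of patterns, stays fixed.
  spider : ∀ k m {x} (ps : List (Leg x)) → All (λ p → length′ p ≤ k) ps → Distinct ps →
    spiderSize r k m ≤ length ps → Unavoidable r G ⊎ Spider m
  spider zero m (p ∷ q ∷ _) (p≤ ∷ q≤ ∷ _) ((p≢q ∷ _) ∷ _) _ =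
    contradiction (stub-ends p q (n≤0⇒n≡0 p≤) (n≤0⇒n≡0 q≤)) p≢q
  spider zero m (p ∷ []) _ _ (s≤s ())
  spider (suc k) m ps ps≤ distinct size≤ with spider-step ps ps≤ distinct size≤
  ... | inj₁ found                                        = inj₁ found
  ... | inj₂ (inj₁ legs)                                  = inj₂ legs
  ... | inj₂ (inj₂ (_ , qs , qs≤ , qs-distinct , large)) = spider k m qs qs≤ qs-distinct large

-- From spiders to subdivisions of K₂,ᵣ

module _ {n} (G : Graph (Fin n)) {r : ℕ} where
  open Graph G
  open Paths G

  module _ (w : Fin n) where
    open Spiders G r (_≢ w) (w ~_)
    open Leg using (length′; at′)

    -- The legs avoid `w` and end in neighbours of `w`; ended at its first neighbour of `w` after
    -- the root, a leg sees `w` from its last vertex only. The root is the other hub, hence the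
    -- shift `suc t`.
    spider-theta : 0 < r → Spider r → Theta G r
    spider-theta 0<r (x , ps , r≤ , nontrivial , apart) = record
      { hub₀ = x ; hub₁ = w
      ; leg = λ j t → at′ (f j) (suc t) ; len = cutLength
      ; hub₀≢hub₁ = λ eq → Leg.inside (f j₀) z≤n (trans (Leg.source (f j₀)) eq)
      ; hub₀∉leg = λ {j} t≤ eq → Leg.injective (f j) (s≤s z≤n) (bound j t≤) (trans (Leg.source (f j)) eq)
      ; hub₁∉leg = λ {j} t≤ eq → Leg.inside (f j) (bound j t≤) (sym eq)
      ; leg-injective = λ {j} t≤ t′≤ eq → suc-injective (Leg.at-injective (f j) (bound j t≤) (bound j t′≤) eq)
      ; leg-edge = λ {j} t< → Leg.edge (f j) (bound j t<)
      ; leg-chordless = λ {j} t< t′≤ e → suc-injective (Leg.chordless (f j) (s≤s t<) (bound j t′≤) e)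
      ; disjoint = λ {i} {j} i≢j t≤ t′≤ → proj₁ (f-apart i≢j (bound i t≤) (bound j t′≤))
      ; nonadjacent = λ {i} {j} i≢j t≤ t′≤ → proj₂ (f-apart i≢j (bound i t≤) (bound j t′≤))
      ; first-edge = λ j → subst (_~ at′ (f j) 1) (Leg.source (f j)) (Leg.edge (f j) (bound j z≤n))
      ; first-only = λ {j} {t} t≤ e → suc-injective (Leg.chordless (f j) (s≤s z≤n) (bound j t≤)
          (subst (_~ at′ (f j) (suc t)) (sym (Leg.source (f j))) e))
      ; last-edge = λ j → proj₁ (proj₂ (proj₂ (cutoff j)))
      ; last-only = λ {j} t≤ e → ≤-antisym t≤ (≮⇒≥ λ t< → proj₂ (proj₂ (proj₂ (cutoff j))) t< e) }
      where
      selected = select {R = Apart} r≤ nontrivial apart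
      f : Fin r → Leg x
      f = proj₁ selected
      -- Some leg is required to see that the root differs from `w`.
      j₀ : Fin r
      j₀ = fromℕ< 0<r
      f-apart : ∀ {i j} → i ≢ j → Apart (f i) (f j)
      f-apart = pairwise {R = Apart} {f = f} (λ {p} {q} → Apart-sym {x} {p} {q}) (λ {i} {j} → proj₂ (proj₂ selected) {i} {j})
      1+pred : ∀ j → suc (pred (length′ (f j))) ≡ length′ (f j)
      1+pred j = suc-pred _ ⦃ ≢-nonZero (proj₁ (proj₂ selected) j) ⦄
      -- The search starts behind the root, which may itself be adjacent to `w`: that is the
      -- optional edge between the hubs.
      cutoff : ∀ j → ∃ λ i → i ≤ pred (length′ (f j)) × w ~ at′ (f j) (suc i) ×
                             (∀ {t} → t < i → ¬ w ~ at′ (f j) (suc t))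
      cutoff j = findFirst (λ i → w ~? at′ (f j) (suc i)) (pred (length′ (f j)))
        (subst (w ~_) (sym (trans (cong (at′ (f j)) (1+pred j)) (Leg.target (f j)))) (Leg.hits (f j)))
      cutLength : Fin r → ℕ
      cutLength j = proj₁ (cutoff j)
      bound : ∀ j {t} → t ≤ cutLength j → suc t ≤ length′ (f j)
      bound j t≤ = subst (suc _ ≤_) (1+pred j) (s≤s (≤-trans t≤ (proj₁ (proj₂ (cutoff j)))))

-- Large degree and the bound on the order

restrict : ∀ {A : Set} {P : A → Set} {R : Rel A 0ℓ} {xs} →
  All P xs → AllPairs R xs → AllPairs (λ x y → P x × P y × R x y) xs
restrict []       []       = []
restrict (p ∷ ps) (r ∷ rs) = All.zipWith (λ (q , r) → p , q , r) (ps , r) ∷ restrict ps rs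

-- The `suc` in `largeDegree` is for the neighbour that becomes the common root of the paths to the
-- other neighbours. `order` asks for a spider with `largeDegree r` legs, whose root has at least
-- that degree.
largeDegree order : ℕ → ℕ
largeDegree r = suc (spiderSize r r r)
order r       = spiderSize r r (largeDegree r)

module _ {n} (G : Graph (Fin n)) (2-connected : IsConnected[ 2 ] G) {r} (2<r : 2 < r) where
  open Graph G
  open Paths G
  open Ladders G
  open Whitney G 2-connected

  -- A cross needs two positions on each rail. The rail `w` has only one, so the ladder is clean
  -- however many neighbours `w` has on `q`.
  fan : ∀ {w s t} → w ~ s → w ~ t → ∃ (Walk (_≢ w) s t) →
        LargeCleanLadder r ⊎ Σ[ q ∈ Path s t ] len q ≤ r × Inside (_≢ w) q
  fan {w} {s} {t} w~s w~t (_ , R) with induce R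
  ... | q , _ , q≢w with r ≤? suc (suc (len q))
  ...   | yes r≤ = inj₁ (ladder {w} {s} {w} {t} L (λ { (s≤s _) () }) w~s w~t 2<r r≤)
    where
    L : Link w s w t
    L = record { p = trivial w ; q = q ; disjoint = λ _ j≤ eq → q≢w j≤ (sym eq) }
  ...   | no r≰ = inj₂ (q , ≤-trans (m≤n+m _ 2) (<⇒≤ (≰⇒> r≰)) , q≢w)

  high-degree : ∀ {w} (vs : List (Fin n)) → All (w ~_) vs → AllPairs _≢_ vs →
    largeDegree r ≤ length vs → Unavoidable r G
  high-degree {w} (s ∷ vs) (w~s ∷ w~vs) (_ ∷ distinct) (s≤s large)
    with sequence (All.map (λ w~t → Sum.map₂ (w~t ,_) (fan w~s w~t
           (walk-avoiding w (λ eq → ~-irrefl (sym eq) w~s) (λ eq → ~-irrefl (sym eq) w~t)))) w~vs)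
  ... | inj₁ found = inj₂ (inj₁ found)
  ... | inj₂ paths = conclude (spider r r (All.reduce leg paths)
          (All-reduce⁺ leg (All.universal (λ { _ (_ , _ , short , _) → short }) vs) paths)
          (AllPairs-reduce⁺ leg (AllPairs.map (λ ≢ _ _ → ≢) distinct) paths)
          (subst (spiderSize r r r ≤_) (sym (length-reduce leg paths)) large))
    where
    open Spiders G r (_≢ w) (w ~_)
    leg : ∀ {t} → w ~ t × (Σ[ q ∈ Path s t ] len q ≤ r × Inside (_≢ w) q) → Leg s
    leg (w~t , q , short , q≢w) = record { route = q ; inside = q≢w ; hits = w~t ; short = short }
    conclude : Unavoidable r G ⊎ Spider r → Unavoidable r G
    conclude (inj₁ found) = found
    conclude (inj₂ legs)  = theta-unavoidable (spider-theta G w (≤-trans (s≤s z≤n) 2<r) legs)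

  -- The start of the induction along a walk: both paths are trivial and the edge is linked to
  -- itself.
  self-linked : ∀ {u u′} → u ~ u′ → Linked u u′ u
  self-linked {u} {u′} u~u′ = u′ , u~u′ , inj₁ record
    { p = trivial u ; q = trivial u′ ; disjoint = λ _ _ eq → ~-irrefl eq u~u′ }

  linked-from : ∀ {u u′} → u ~ u′ → ∀ v → Linked u u′ v
  linked-from {u} {u′} u~u′ v with v Fin.≟ u
  ... | yes refl = self-linked u~u′
  ... | no  v≢u with _ , R ← walk-avoiding u (λ eq → ~-irrefl (sym eq) u~u′) v≢u =
        linked (self-linked u~u′) (step tt u~u′ (mapWalk (λ _ → tt) R))

  -- One short path from `u` to each vertex gives `n` legs with distinct ends.
  unavoidable : ∀ {u u′} → u ~ u′ → order r ≤ n → Unavoidable r G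
  unavoidable {u} {u′} u~u′ large with sequence (All.universal (λ v → ladder-or-path 2<r u~u′ (linked-from u~u′ v)) (allFin n))
  ... | inj₁ found = inj₂ (inj₁ found)
  ... | inj₂ paths = conclude (spider r (largeDegree r) (All.reduce leg paths)
          (All-reduce⁺ leg (All.universal (λ { _ (_ , short) → short }) (allFin n)) paths)
          (AllPairs-reduce⁺ leg (AllPairs.map (λ ≢ _ _ → ≢) (allFin⁺ n)) paths)
          (subst (order r ≤_) (sym (trans (length-reduce leg paths) (length-tabulate (λ i → i)))) large))
    where
    open Spiders G r (λ _ → ⊤) (λ _ → ⊤)
    open Leg using (length′; at′)
    leg : ∀ {v} → ShortPath 2<r u v → Leg u
    leg (p , short) = record { route = p ; inside = λ _ → tt ; hits = tt ; short = short }
    conclude : Unavoidable r G ⊎ Spider (largeDegree r) → Unavoidable r G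
    conclude (inj₁ found) = found
    -- The root `w` may differ from `u`, since legs may have been cut. The second vertices of the
    -- legs are neighbours of `w`, distinct because the legs are apart.
    conclude (inj₂ (w , ps , many , nontrivial , apart)) = high-degree {w} (map (λ p → at′ p 1) ps)
      (All.map⁺ (All.map (λ {p} ≢0 → subst (_~ at′ p 1) (Leg.source p) (Leg.edge p (n≢0⇒n>0 ≢0))) nontrivial))
      (AllPairs.map⁺ (AllPairs.map (λ (p≢0 , q≢0 , apart) → proj₁ (apart (n≢0⇒n>0 p≢0) (n≢0⇒n>0 q≢0)))
        (restrict nontrivial apart)))
      (subst (largeDegree r ≤_) (sym (length-map _ ps)) many)

-- The order exceeds 2, so a third vertex can be deleted, and a walk between the two distinct
-- vertices 0 and 1 has a first edge.
some-edge : ∀ {n} (G : Graph (Fin n)) → IsConnected[ 2 ] G → ∃ λ u → ∃ λ v → Graph._~_ G u v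
some-edge {suc (suc (suc n))} G 2-connected
  with Whitney.walk-avoiding G 2-connected {zero} {suc zero} (suc (suc zero)) (λ ()) (λ ())
... | _ , Paths.step _ e _ = _ , _ , e
some-edge {suc (suc zero)} G (s≤s (s≤s ()) , _)
some-edge {suc zero} G (s≤s () , _)

theorem1p4 : (r : ℕ) → 2 < r →
    Σ[ N ∈ ℕ ] ((n : ℕ) (G : Graph (Fin n)) → N ≤ n → IsConnected[ 2 ] G →
    (complete r ↪ G)
    ⊎ (Σ[ k ∈ ℕ ] Σ[ L ∈ Graph (Fin k) ] (r ≤ k × IsCleanLadder L × L ↪ G))
    ⊎ (Σ[ s ∈ (Fin 2 → Fin r → ℕ) ] (subdividedK₂ s ↪ G))
    ⊎ (Σ[ s ∈ (Fin 2 → Fin r → ℕ) ] (subdividedK₂⁺ s ↪ G)))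
theorem1p4 r 2<r = order r , λ n G large 2-connected →
  let _ , _ , u~v = some-edge G 2-connected in unavoidable G 2-connected 2<r u~v large
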